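{- Let $m\in\mathbb{N}$ and let $p_1,\ldots,p_m$ be minimal idempotents in $(\beta\mathbb{N},+)$. Then for every $A\in\bigotimes_{i=1}^m p_i$ and every $T\in\mathcal{P}_f(\mathbb{P})$ there exist functions $\alpha_1,\ldots,\alpha_m:\mathcal{P}_f(\mathbb{N}^{\mathbb{N}})\to\mathbb{N}$ and $H_1,\ldots,H_m:\mathcal{P}_f(\mathbb{N}^{\mathbb{N}})\to\mathcal{P}_f(\mathbb{N})$ such that (1) if $G,K\in\mathcal{P}_f(\mathbb{N}^{\mathbb{N}})$ and $G\subsetneq K$, then $H_i(G)<H_i(K)$ for every $i\in\{1,\ldots,m\}$; and (2) if $n\in\mathbb{N}$ with $n\ge m$, and $G_1\subsetneq G_2\subsetneq\cdots\subsetneq G_n$ in $\mathcal{P}_f(\mathbb{N}^{\mathbb{N}})$, then for all $\beta_1<\beta_2<\cdots<\beta_m$ in $\mathcal{P}_f(\mathbb{N})$ with $\max\beta_m\le n$, all $f_i\in G_i$ ($i\in\{1,\ldots,n\}$), and all $P_1,\ldots,P_m\in T$, $$\left(\sum_{i\in\beta_1}\alpha_1(G_i)+P_1\Bigl(\sum_{i\in\beta_1}\sum_{t\in H_1(G_i)}f_i(t)\Bigr),\ldots,\sum_{i\in\beta_m}\alpha_m(G_i)+P_m\Bigl(\sum_{i\in\beta_m}\sum_{t\in H_m(G_i)}f_i(t)\Bigr)\right)\in A.$$ In fact, the same holds for arbitrary idempotents $p_1,\ldots,p_m$ of $(\mathcal{J}_p,+)$ (in place of minimal idempotents).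
   Context: $\mathbb{N}$ is the set of positive integers; $\mathcal{P}_f(X)$ is the set of nonempty finite subsets of $X$; $\mathbb{N}^{\mathbb{N}}$ is the set of all functions $\mathbb{N}\to\mathbb{N}$. For $\beta,\gamma\in\mathcal{P}_f(\mathbb{N})$, $\beta<\gamma$ means $\max\beta<\min\gamma$. $\mathbb{P}$ is the set of one-variable polynomials with integer coefficients and zero constant term. $\beta\mathbb{N}$ is the set of ultrafilters on $\mathbb{N}$, with the Stone topology and the operation: $A\in p+q$ iff $\{x\in\mathbb{N}:-x+A\in q\}\in p$, where $-x+A=\{y\in\mathbb{N}:x+y\in A\}$. An ultrafilter $p$ is idempotent if $p+p=p$; a minimal idempotent is an idempotent lying in $K(\beta\mathbb{N},+)$, the smallest two-sided ideal (the union of all minimal left ideals) of $(\beta\mathbb{N},+)$. A set $A\subseteq\mathbb{N}$ is a $J_p$-set if for every $F\in\mathcal{P}_f(\mathbb{P})$ and every $H\in\mathcal{P}_f(\mathbb{N}^{\mathbb{N}})$ there exist $a\in\mathbb{N}$ and $\beta\in\mathcal{P}_f(\mathbb{N})$ such that $a+P(\sum_{t\in\beta}f(t))\in A$ for all $P\in F$ and $f\in H$. $\mathcal{J}_p=\{q\in\beta\mathbb{N}:\text{every }A\in q\text{ is a }J_p\text{ -set}\}$ (the subscript $p$ stands for "polynomial" and is not an ultrafilter); it is a two-sided ideal of $(\beta\mathbb{N},+)$. Tensor products: for ultrafilters $p_1,\ldots,p_k$ on $\mathbb{N}$, $\bigotimes_{i=1}^k p_i$ is the ultrafilter on $\mathbb{N}^k$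 defined recursively by $\bigotimes_{i=1}^1p_i=p_1$, and, for $A\subseteq\mathbb{N}^{k+1}$, $A\in\bigotimes_{i=1}^{k+1}p_i$ iff $\{(x_1,\ldots,x_k)\in\mathbb{N}^k:\{x_{k+1}\in\mathbb{N}:(x_1,\ldots,x_{k+1})\in A\}\in p_{k+1}\}\in\bigotimes_{i=1}^kp_i$. -}

module Defs where

open import Data.Fin.Base using (Fin; zero; suc; inject₁; fromℕ)
open import Data.Integer.Base using (ℤ; +_; 0ℤ) renaming (_+_ to _+ℤ_; _*_ to _*ℤ_)
open import Data.List.Base using (List; []; _∷_; map)
import Data.List.Extrema.Nat as Extrema
import Data.List.Membership.Propositional as List
import Data.List.Relation.Binary.Subset.Propositional as List
open import Data.List.NonEmpty.Base as List⁺ using (List⁺; head; tail)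
open import Data.List.Relation.Unary.Unique.Propositional using (Unique)
open import Data.Nat.Base using (ℕ; zero; suc; _+_; _≤_; _<_; NonZero)
open import Data.Nat.ListAction using (sum)
open import Data.Product.Base using (Σ-syntax; ∃-syntax; _×_; _,_)
open import Data.Sum.Base using (_⊎_; inj₁; inj₂)
open import Data.Unit.Base using (tt)
open import Data.Vec.Base using (Vec; []; _∷_; _∷ʳ_; lookup)
open import Function.Base using (_∘_)
open import Function.Definitions using (Congruent)
open import Level using (0ℓ) renaming (suc to lsuc)
open import Relation.Binary.Core using (Rel)
open import Relation.Binary.PropositionalEquality.Core using (_≡_)
open import Relation.Nullary.Negation.Core using (¬_)
open import Relation.Unary using (Pred; _∈_; _∉_; _⊆_; _≐_; _∩_; ∁; U; ∅; Satisfiable)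

record ℕ⁺ : Set where
  constructor pos
  field
    value        : ℕ
    .{{nonZero}} : NonZero value

open ℕ⁺ public using (value)

1⁺ : ℕ⁺
1⁺ = pos 1

infixl 6 _+⁺_
_+⁺_ : ℕ⁺ → ℕ⁺ → ℕ⁺
pos m +⁺ pos n = pos (m + n) {{+-nonZero m n}}
  where
  +-nonZero : ∀ m n → .{{NonZero m}} → NonZero (m + n)
  +-nonZero (suc m) n = record { nonZero = tt }

ℕ⁺^ℕ⁺ : Set
ℕ⁺^ℕ⁺ = ℕ⁺ → ℕ⁺

-- A set is given by a duplicate-free enumeration.  Different enumerations of
-- the same set are identified by _≋_, which a function on 𝒫f X must respect.
-- For X a function type, _≡_ is the intended equality under extensionality.
record 𝒫f (X : Set) : Set where
  field
    elements : List⁺ X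
    unique   : Unique (List⁺.toList elements)

  toList : List X
  toList = List⁺.toList elements

open 𝒫f public using (elements; toList)

infix 4 _∈ᶠ_ _⊆ᶠ_ _⊊_ _≋_ _≺_

_∈ᶠ_ : {X : Set} → X → 𝒫f X → Set
x ∈ᶠ G = x List.∈ toList G

_⊆ᶠ_ _⊊_ _≋_ : {X : Set} → Rel (𝒫f X) 0ℓ
G ⊆ᶠ K = toList G List.⊆ toList K
G ⊊ K  = G ⊆ᶠ K × ¬ (K ⊆ᶠ G)
G ≋ K  = G ⊆ᶠ K × K ⊆ᶠ G

-- Extrema.min x xs and Extrema.max x xs range over x as well as xs.
minᶠ maxᶠ : 𝒫f ℕ⁺ → ℕ
minᶠ β = Extrema.min (value (head (elements β))) (map value (tail (elements β)))
maxᶠ β = Extrema.max (value (head (elements β))) (map value (tail (elements β)))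

_≺_ : Rel (𝒫f ℕ⁺) 0ℓ
β ≺ γ = maxᶠ β < minᶠ γ

∑ : 𝒫f ℕ⁺ → (ℕ⁺ → ℕ) → ℕ
∑ β g = sum (map g (toList β))

-- c₁ ∷ … ∷ c_d ∷ [] stands for c₁ x + … + c_d x^d.  Lists differing by trailing
-- zeros denote the same polynomial; polynomials are only ever evaluated.
ℙ : Set
ℙ = List ℤ

eval : ℙ → ℤ → ℤ
eval []       x = 0ℤ
eval (c ∷ cs) x = (c +ℤ eval cs x) *ℤ x

infix 4 _∈ℤ_ _∈ℤᵏ_

_∈ℤ_ : ℤ → Pred ℕ⁺ 0ℓ → Set
z ∈ℤ A = ∃[ n ] + value n ≡ z × n ∈ A

_∈ℤᵏ_ : ∀ {k} → (Fin k → ℤ) → Pred (Vec ℕ⁺ k) 0ℓ → Set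
z ∈ℤᵏ A = ∃[ v ] (∀ j → + value (lookup v j) ≡ z j) × v ∈ A

record Ultrafilter (X : Set) : Set₁ where
  field
    Sets   : Pred (Pred X 0ℓ) 0ℓ
    full   : U ∈ Sets
    proper : ∅ ∉ Sets
    upward : ∀ {A B} → A ⊆ B → A ∈ Sets → B ∈ Sets
    inter  : ∀ {A B} → A ∈ Sets → B ∈ Sets → A ∩ B ∈ Sets
    ultra  : ∀ A → A ∈ Sets ⊎ ∁ A ∈ Sets

open Ultrafilter public using (Sets)

infix 4 _≈_
_≈_ : {X : Set} → Rel (Ultrafilter X) (lsuc 0ℓ)
p ≈ q = Sets p ≐ Sets q

-- The image of the tensor product of p and q under a binary operation.  Both
-- the sum on βℕ and the iterated tensor products are instances.
combine : {X Y Z : Set} → (X → Y → Z) → Ultrafilter X → Ultrafilter Y → Ultrafilter Z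
combine _∙_ p q = record
  { Sets   = λ A → (λ x → (λ y → A (x ∙ y)) ∈ Sets q) ∈ Sets p
  ; full   = P.upward (λ _ → Q.full) P.full
  ; proper = λ ∅∈ → P.proper (P.upward Q.proper ∅∈)
  ; upward = λ A⊆B → P.upward (Q.upward A⊆B)
  ; inter  = λ A∈ B∈ → P.upward (λ (a , b) → Q.inter a b) (P.inter A∈ B∈)
  ; ultra  = ultra
  }
  where
  module P = Ultrafilter p
  module Q = Ultrafilter q

  ultra : ∀ A → _ ⊎ _
  ultra A with P.ultra (λ x → (λ y → A (x ∙ y)) ∈ Sets q)
  ... | inj₁ A∈ = inj₁ A∈
  ... | inj₂ A∉ = inj₂ (P.upward (λ {x} → complement x) A∉)
    where
    complement : ∀ x → (λ y → A (x ∙ y)) ∉ Sets q → (λ y → ¬ A (x ∙ y)) ∈ Sets q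
    complement x ∉q with Q.ultra (λ y → A (x ∙ y))
    ... | inj₁ ∈q with () ← ∉q ∈q
    ... | inj₂ ∁∈q = ∁∈q

mapᵘ : {X Y : Set} → (X → Y) → Ultrafilter X → Ultrafilter Y
mapᵘ f p = record
  { Sets   = λ A → A ∘ f ∈ Sets p
  ; full   = P.full
  ; proper = P.proper
  ; upward = λ A⊆B → P.upward A⊆B
  ; inter  = P.inter
  ; ultra  = λ A → P.ultra (A ∘ f)
  }
  where module P = Ultrafilter p

βℕ : Set₁
βℕ = Ultrafilter ℕ⁺

infixl 6 _⊕_
_⊕_ : βℕ → βℕ → βℕ
_⊕_ = combine _+⁺_

⨂ : ∀ {k} → (Fin (suc k) → βℕ) → Ultrafilter (Vec ℕ⁺ (suc k))
⨂ {zero}  p = mapᵘ (λ x → x ∷ []) (p zero)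
⨂ {suc k} p = combine _∷ʳ_ (⨂ (p ∘ inject₁)) (p (fromℕ (suc k)))

Idempotent : Pred βℕ (lsuc 0ℓ)
Idempotent p = p ⊕ p ≈ p

-- Ultrafilters form a setoid under _≈_, so a subset of βℕ has to respect _≈_.
record LeftIdeal (L : Pred βℕ (lsuc 0ℓ)) : Set₁ where
  field
    nonempty : Satisfiable L
    respects : ∀ {p q} → p ≈ q → p ∈ L → q ∈ L
    absorbs  : ∀ q {p} → p ∈ L → q ⊕ p ∈ L

MinimalLeftIdeal : Pred (Pred βℕ (lsuc 0ℓ)) (lsuc (lsuc 0ℓ))
MinimalLeftIdeal L = LeftIdeal L × (∀ L′ → LeftIdeal L′ → L′ ⊆ L → L ⊆ L′)

-- The smallest two-sided ideal is the union of all minimal left ideals.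
K[βℕ] : Pred βℕ (lsuc (lsuc 0ℓ))
K[βℕ] p = ∃[ L ] MinimalLeftIdeal L × p ∈ L

MinimalIdempotent : Pred βℕ (lsuc (lsuc 0ℓ))
MinimalIdempotent p = Idempotent p × p ∈ K[βℕ]

Jₚ-set : Pred (Pred ℕ⁺ 0ℓ) 0ℓ
Jₚ-set A = (F : 𝒫f ℙ) (H : 𝒫f ℕ⁺^ℕ⁺) →
  Σ[ a ∈ ℕ⁺ ] Σ[ β ∈ 𝒫f ℕ⁺ ] (∀ P f → P ∈ᶠ F → f ∈ᶠ H →
    (+ value a +ℤ eval P (+ ∑ β (value ∘ f))) ∈ℤ A)

𝒥ₚ : Pred βℕ (lsuc 0ℓ)
𝒥ₚ q = ∀ A → A ∈ Sets q → Jₚ-set A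

-- Here m = suc k.  Sequences of length n (G and f) are indexed by all of ℕ⁺, but
-- only the terms with index at most n are constrained or used, since max β_m ≤ n.
CentralSetsConclusion : ∀ {k} → (Fin (suc k) → βℕ) → Set₁
CentralSetsConclusion {k} p =
  (A : Pred (Vec ℕ⁺ (suc k)) 0ℓ) → A ∈ Sets (⨂ p) → (T : 𝒫f ℙ) →
  Σ[ α ∈ (Fin (suc k) → 𝒫f ℕ⁺^ℕ⁺ → ℕ⁺) ]
  Σ[ H ∈ (Fin (suc k) → 𝒫f ℕ⁺^ℕ⁺ → 𝒫f ℕ⁺) ]
    (∀ j → Congruent _≋_ _≡_ (α j)) ×
    (∀ j → Congruent _≋_ _≋_ (H j)) ×
    (∀ G K → G ⊊ K → ∀ j → H j G ≺ H j K) ×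
    (∀ (n : ℕ) → suc k ≤ n →
     (G : ℕ⁺ → 𝒫f ℕ⁺^ℕ⁺) → (∀ i → value i < n → G i ⊊ G (i +⁺ 1⁺)) →
     (β : Fin (suc k) → 𝒫f ℕ⁺) → (∀ (j : Fin k) → β (inject₁ j) ≺ β (suc j)) →
     maxᶠ (β (fromℕ k)) ≤ n →
     (f : ℕ⁺ → ℕ⁺^ℕ⁺) → (∀ i → value i ≤ n → f i ∈ᶠ G i) →
     (P : Fin (suc k) → ℙ) → (∀ j → P j ∈ᶠ T) →
     (λ j → + ∑ (β j) (λ i → value (α j (G i)))
              +ℤ eval (P j) (+ ∑ (β j) (λ i → ∑ (H j (G i)) (λ t → value (f i t)))))
       ∈ℤᵏ A)

{-# OPTIONS --safe #-}
module Submission where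

-- An idempotent p of 𝒥ₚ supports a recursion over the finite sets G of functions,
-- ordered by strict inclusion: only finitely many partial sums (a , s), with s the
-- argument of the polynomials, come from chains strictly below G.  If every a + P s
-- lies in the starred set {y ∈ B : −y + B ∈ p}, then intersecting finitely many members
-- of p and applying the Jₚ property to the increments x ↦ P (s + x) − P s yields α G
-- and H G that prolong all these sums at once.  For a tensor product one runs this
-- recursion factor by factor: the finitely many tuples already completed strictly
-- below G play the role of parameters of the set B.
--
-- Minimal idempotents lie in 𝒥ₚ: if p is minimal and A ∈ p, then {y : −y + A ∈ p} is
-- syndetic, and the IP polynomial van der Waerden theorem, proved by colour focusing
-- and PET induction, applies to the finite colouring by the covering shifts.

open import Defs
open import Axiom.ExcludedMiddle using (ExcludedMiddle)
open import Axiom.Extensionality.Propositional using (Extensionality)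
open import Data.Bool.Base using (Bool; true; false)
open import Data.Empty using (⊥; ⊥-elim)
open import Data.Fin.Base using (Fin; zero; suc; funToFin; finToFun; toℕ; fromℕ<; inject₁;
  fromℕ)
open import Data.Fin.Properties using (any?; finToFun-funToFin; pigeonhole; toℕ-fromℕ<)
  renaming (_≟_ to _≟ᶠ_; <⇒≢ to <⇒≢ᶠ)
open import Data.Fin.Relation.Unary.Top using (view; ‵fromℕ; ‵inj₁)
open import Data.Integer.Base using (ℤ; +_; 0ℤ; -1ℤ; _-_; +[1+_]; -[1+_]; ∣_∣) renaming (_+_
  to _+ℤ_; _*_ to _*ℤ_)
import Data.Integer.Properties as ℤ
open import Data.Integer.Solver using (module +-*-Solver)
open import Data.List.Base using (List; []; _∷_; _++_; map; concat; concatMap; length;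
  cartesianProductWith; cartesianProduct; filter; deduplicate) renaming (lookup to lookupˡ)
import Data.List.Extrema.Nat as Extrema
open import Data.List.Membership.Propositional using () renaming (_∈_ to _∈ˡ_)
open import Data.List.Membership.Propositional.Properties using (∈-map⁺; ∈-map⁻; ∈-++⁺ˡ;
  ∈-++⁺ʳ; ∈-++⁻; ∈-concat⁺′; ∈-concat⁻′; ∈-cartesianProductWith⁺; ∈-cartesianProductWith⁻;
  ∈-cartesianProduct⁺; ∈-cartesianProduct⁻; ∈-filter⁺; ∈-filter⁻; ∈-deduplicate⁺;
  ∈-deduplicate⁻; ∈-∃++)
open import Data.List.NonEmpty.Base as List⁺ using (head; tail; _∷_; List⁺)
open import Data.List.Properties using (concatMap-++; ++-identityʳ; ++-assoc; map-++; map-∘;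
  map-cong-local; length-++)
open import Data.List.Relation.Binary.Permutation.Propositional using (_↭_; ↭-sym; ↭⇒↭ₛ)
open import Data.List.Relation.Binary.Permutation.Propositional.Properties using (∈-resp-↭)
  renaming (map⁺ to ↭-map⁺)
import Data.List.Relation.Binary.Permutation.Setoid.Properties as ↭ₛ
open import Data.List.Relation.Binary.Subset.Propositional using () renaming (_⊆_ to _⊆ˡ_)
open import Data.List.Relation.Binary.Subset.Propositional.Properties using (++⁺)
open import Data.List.Relation.Unary.All as All using (All; []; _∷_)
import Data.List.Relation.Unary.All.Properties as All
open import Data.List.Relation.Unary.AllPairs as AllPairs using (AllPairs; []; _∷_)
import Data.List.Relation.Unary.AllPairs.Properties as AllPairs
open import Data.List.Relation.Unary.Any as Any using (Any; here; there)
open import Data.List.Relation.Unary.Any.Properties using (lookup-index)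
open import Data.List.Relation.Unary.Linked.Properties using (Linked⇒AllPairs)
open import Data.List.Relation.Unary.Unique.DecPropositional.Properties using (deduplicate-!)
open import Data.List.Relation.Unary.Unique.Propositional using (Unique)
import Data.List.Relation.Unary.Unique.Propositional.Properties as Unique
import Data.List.Sort as Sort
open import Data.Nat.Base using (ℕ; zero; suc; _+_; _≤_; _<_; _^_; s≤s; z≤n; _≤′_; ≤′-refl;
  ≤′-step)
open import Data.Nat.ListAction using (sum)
open import Data.Nat.ListAction.Properties using (sum-++; sum-↭)
import Data.Nat.Properties as ℕ
open import Data.Product.Base using (Σ-syntax; ∃-syntax; _×_; _,_; proj₁; proj₂)
open import Data.Sum.Base using (_⊎_; inj₁; inj₂)
open import Data.Vec.Base as Vec using (Vec; []; _∷_; lookup; _∷ʳ_) renaming (toList to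
  toListᵛ)
open import Data.Vec.Membership.Propositional.Properties using (∈-lookup; ∈-toList⁺)
open import Data.Vec.Properties using (lookup-map)
import Data.Vec.Relation.Unary.All as VAll
import Data.Vec.Relation.Unary.All.Properties as VAll
import Data.Vec.Relation.Unary.AllPairs as VAllPairs
import Data.Vec.Relation.Unary.Any as VAny
import Data.Vec.Relation.Unary.Any.Properties as VAny
open import Data.Vec.Relation.Unary.Unique.Propositional using () renaming (Unique to Uniqueᵛ)
open import Data.Vec.Relation.Unary.Unique.Propositional.Properties using (lookup-injective)
open import Function.Base using (_∘_)
open import Function.Bundles using (mk⇔)
open import Level using (0ℓ) renaming (suc to lsuc)
import Relation.Binary.Construct.On as On
open import Relation.Binary.Definitions using (DecidableEquality)
open import Relation.Binary.PropositionalEquality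
open import Relation.Nullary using (¬_; yes; no; Dec; does)
open import Relation.Nullary.Decidable using (does-⇔; dec-true; ¬?)
open import Relation.Unary using (Pred; _∈_; Decidable)

open +-*-Solver using (solve; con; _:+_; _:*_; _:-_; _:=_)

-- Set polynomials and colour focusing

-- Lists stand for finite sets of indices and `_++_` for disjoint union. The functions of interest
-- send a list to `eval P` of the sum of some `f` over it.
Φ : Set
Φ = List ℕ⁺ → ℤ

Δ : List ℕ⁺ → Φ → Φ
Δ γ φ l = φ (γ ++ l) - φ l - φ γ

-- Subtracting `φ γ` in `Δ` removes the constant term, so the count begins with the zero function in
-- degree 0 and the additive functions in degree 1.
data Deg : ℕ → Pred Φ 0ℓ where
  deg-zero : ∀ {φ} → (∀ l → φ l ≡ 0ℤ) → Deg 0 φ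
  deg-suc  : ∀ {d φ} → (∀ γ → Deg d (Δ γ φ)) → Deg (suc d) φ

Deg-resp : ∀ {d φ ψ} → φ ≗ ψ → Deg d φ → Deg d ψ
Deg-resp φ≗ψ (deg-zero a) = deg-zero λ l → trans (sym (φ≗ψ l)) (a l)
Deg-resp φ≗ψ (deg-suc a)  = deg-suc λ γ → Deg-resp
  (λ l → cong₂ _-_ (cong₂ _-_ (φ≗ψ (γ ++ l)) (φ≗ψ l)) (φ≗ψ γ)) (a γ)

Deg-+ : ∀ {d φ ψ} → Deg d φ → Deg d ψ → Deg d (λ l → φ l +ℤ ψ l)
Deg-+ (deg-zero a) (deg-zero b) = deg-zero λ l → cong₂ _+ℤ_ (a l) (b l)
Deg-+ {φ = φ} {ψ} (deg-suc a) (deg-suc b) = deg-suc λ γ → Deg-resp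
  (λ l → lemma (φ (γ ++ l)) (φ l) (φ γ) (ψ (γ ++ l)) (ψ l) (ψ γ))
  (Deg-+ (a γ) (b γ))
  where
  lemma : ∀ x y z u v w → (x - y - z) +ℤ (u - v - w) ≡ (x +ℤ u) - (y +ℤ v) - (z +ℤ w)
  lemma = solve 6 (λ x y z u v w →
    (x :- y :- z) :+ (u :- v :- w) := (x :+ u) :- (y :+ v) :- (z :+ w)) refl

Deg-*ᶜ : ∀ {d φ} c → Deg d φ → Deg d (λ l → φ l *ℤ c)
Deg-*ᶜ c (deg-zero a) = deg-zero λ l → trans (cong (_*ℤ c) (a l)) (ℤ.*-zeroˡ c)
Deg-*ᶜ {φ = φ} c (deg-suc a) = deg-suc λ γ → Deg-resp
  (λ l → lemma (φ (γ ++ l)) (φ l) (φ γ) c) (Deg-*ᶜ c (a γ))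
  where
  lemma : ∀ x y z c → (x - y - z) *ℤ c ≡ x *ℤ c - y *ℤ c - z *ℤ c
  lemma = solve 4 (λ x y z c → (x :- y :- z) :* c := x :* c :- y :* c :- z :* c) refl

Deg-- : ∀ {d φ ψ} → Deg d φ → Deg d ψ → Deg d (λ l → φ l - ψ l)
Deg-- {φ = φ} {ψ} a b = Deg-resp (λ l → lemma (φ l) (ψ l)) (Deg-+ a (Deg-*ᶜ -1ℤ b))
  where
  lemma : ∀ x y → x +ℤ y *ℤ -1ℤ ≡ x - y
  lemma = solve 2 (λ x y → x :+ y :* con -1ℤ := x :- y) refl

Deg-suc : ∀ {d φ} → Deg d φ → Deg (suc d) φ
Deg-suc (deg-zero a) = deg-suc λ γ → deg-zero λ l →
  cong₂ _-_ (cong₂ _-_ (a (γ ++ l)) (a l)) (a γ)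
Deg-suc (deg-suc a)  = deg-suc λ γ → Deg-suc (a γ)

Deg-mono : ∀ {d e φ} → d ≤ e → Deg d φ → Deg e φ
Deg-mono d≤e a = go (ℕ.≤⇒≤′ d≤e) a
  where
  go : ∀ {d e φ} → d ≤′ e → Deg d φ → Deg e φ
  go ≤′-refl       a = a
  go (≤′-step d≤e) a = Deg-suc (go d≤e a)

Additive : Pred Φ 0ℓ
Additive σ = ∀ γ l → σ (γ ++ l) ≡ σ γ +ℤ σ l

Additive⇒Deg : ∀ σ → Additive σ → Deg 1 σ
Additive⇒Deg σ add = deg-suc λ γ → deg-zero λ l →
  trans (cong (λ s → s - σ l - σ γ) (add γ l)) (lemma (σ γ) (σ l))
  where
  lemma : ∀ x y → x +ℤ y - y - x ≡ 0ℤ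
  lemma = solve 2 (λ x y → x :+ y :- y :- x := con 0ℤ) refl

-- Product rule: the difference of the product is `φ l` times `σ γ`, plus `φ γ` times `σ l`, plus
-- `Δ γ φ l` times `σ l + σ γ`. The induction is on the degree of `φ`, which drops in the last term.
Deg-*-additive : ∀ {d φ} σ → Additive σ → Deg d φ → Deg (suc d) (λ l → φ l *ℤ σ l)
Deg-*-additive σ add (deg-zero a) = Deg-suc (deg-zero λ l →
  trans (cong (_*ℤ σ l) (a l)) (ℤ.*-zeroˡ (σ l)))
Deg-*-additive {φ = φ} σ add deg@(deg-suc a) = deg-suc λ γ → Deg-resp (expand γ)
  (Deg-+
    (Deg-+ (Deg-*ᶜ (σ γ) deg) (Deg-*ᶜ (φ γ) (Deg-mono (s≤s z≤n) (Additive⇒Deg σ add))))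
    (Deg-+ (Deg-*-additive σ add (a γ)) (Deg-suc (Deg-*ᶜ (σ γ) (a γ)))))
  where
  lemma : ∀ x y z s t → y *ℤ s +ℤ t *ℤ z +ℤ ((x - y - z) *ℤ t +ℤ (x - y - z) *ℤ s)
        ≡ x *ℤ (s +ℤ t) - y *ℤ t - z *ℤ s
  lemma = solve 5 (λ x y z s t →
    y :* s :+ t :* z :+ ((x :- y :- z) :* t :+ (x :- y :- z) :* s)
      := x :* (s :+ t) :- y :* t :- z :* s) refl
  expand : ∀ γ → _ ≗ Δ γ (λ l → φ l *ℤ σ l)
  expand γ l = trans (lemma (φ (γ ++ l)) (φ l) (φ γ) (σ γ) (σ l))
    (cong (λ s → φ (γ ++ l) *ℤ s - φ l *ℤ σ l - φ γ *ℤ σ γ) (sym (add γ l)))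

eval-Deg : ∀ P σ → Additive σ → Deg (length P) (λ l → eval P (σ l))
eval-Deg []       σ add = deg-zero λ _ → refl
eval-Deg (c ∷ cs) σ add = Deg-resp (λ l → lemma c (eval cs (σ l)) (σ l))
  (Deg-+ (Deg-*ᶜ c (Deg-mono (s≤s z≤n) (Additive⇒Deg σ add)))
         (Deg-*-additive σ add (eval-Deg cs σ add)))
  where
  lemma : ∀ c x y → y *ℤ c +ℤ x *ℤ y ≡ (c +ℤ x) *ℤ y
  lemma = solve 3 (λ c x y → y :* c :+ x :* y := (c :+ x) :* y) refl

infix 4 _<⁺_
_<⁺_ : ℕ⁺ → ℕ⁺ → Set
s <⁺ t = value s < value t

-- The lower bound `N` lets a list found later be appended to all earlier ones, so that `_++_`
-- remains a disjoint union.
record After (N : ℕ) (β : List ℕ⁺) : Set where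
  constructor after
  field
    nonempty   : β ≢ []
    increasing : AllPairs _<⁺_ β
    above      : All (λ t → N < value t) β

After-++ : ∀ {N M γ β} → N ≤ M → After N γ → All (λ t → value t ≤ M) γ → After M β →
           After N (γ ++ β)
After-++ {γ = []}    N≤M (after ne _ _) _ _ = ⊥-elim (ne refl)
After-++ {γ = _ ∷ _} N≤M (after _ incγ abγ) γ≤M (after _ incβ abβ) = after (λ ())
  (AllPairs.++⁺ incγ incβ (All.map (λ t≤M → All.map (ℕ.≤-<-trans t≤M) abβ) γ≤M))
  (All.++⁺ abγ (All.map (ℕ.≤-<-trans N≤M) abβ))

After-weaken : ∀ {N M β} → N ≤ M → After M β → After N β
After-weaken N≤M (after ne inc ab) = after ne inc (All.map (ℕ.≤-<-trans N≤M) ab)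

∈⇒≤sum : ∀ {n ns} → n ∈ˡ ns → n ≤ sum ns
∈⇒≤sum (here refl) = ℕ.m≤m+n _ _
∈⇒≤sum (there n∈)  = ℕ.≤-trans (∈⇒≤sum n∈) (ℕ.m≤n+m _ _)

Mono : ∀ {k} → (ℤ → Fin k) → List Φ → ℤ × List ℕ⁺ → Set
Mono c A (a , β) = ∀ {φ} → φ ∈ˡ A → c (a +ℤ φ β) ≡ c a

-- Finitely many candidates (a , β) suffice for all colourings at once; this
-- is what makes block colourings have finitely many colours.
VdW : List Φ → Set
VdW A = ∀ k N → Σ[ L ∈ List (ℤ × List ℕ⁺) ]
  (∀ {x} → x ∈ˡ L → After N (proj₂ x)) ×
  (∀ (c : ℤ → Fin k) → ∃[ x ] x ∈ˡ L × Mono c A x)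

-- These displacements occur when a focus is moved by `- p β`: `φ - p` along the new ray, and along
-- a ray `γ` lengthened by `l` the increment of `φ` from `γ` to `γ ++ l`, again less `p`.
perturb : Φ → List (List ℕ⁺) → Φ → List Φ
perturb p Γ φ = (λ l → φ l - p l) ∷ map (λ γ l → φ (γ ++ l) - φ γ - p l) Γ

-- Each ray is monochromatic in its own colour, and no two rays share a colour with each other or
-- with the focus `a`. Hence `r` is smaller than `k`.
Focused : ∀ {k r} → (ℤ → Fin k) → List Φ → ℤ × Vec (List ℕ⁺) r → Set
Focused {k} {r} c A (a , βs) = Σ[ cols ∈ Vec (Fin k) r ]
  (∀ i {φ} → φ ∈ˡ A → c (a +ℤ φ (lookup βs i)) ≡ lookup cols i) × Uniqueᵛ (c a ∷ cols)

MonoOrFocused : List Φ → ℕ → ℕ → ℕ → Set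
MonoOrFocused A k N r =
  Σ[ L₁ ∈ List (ℤ × List ℕ⁺) ] Σ[ L₂ ∈ List (ℤ × Vec (List ℕ⁺) r) ]
  (∀ {x} → x ∈ˡ L₁ → After N (proj₂ x)) ×
  (∀ {x} → x ∈ˡ L₂ → ∀ i → After N (lookup (proj₂ x) i)) ×
  (∀ (c : ℤ → Fin k) →
    (∃[ x ] x ∈ˡ L₁ × Mono c A x) ⊎ (∃[ x ] x ∈ˡ L₂ × Focused c A x))

-- One colour stores the `c`-colours of the whole translate of `Q` by `z`, so equality of two block
-- colours compares all positions of `Q` at once.
block : ∀ {k} (Q : List ℤ) → (ℤ → Fin k) → ℤ → Fin (k ^ length Q)
block Q c z = funToFin (λ i → c (z +ℤ lookupˡ Q i))

block-≡ : ∀ {k} Q (c : ℤ → Fin k) y z → block Q c y ≡ block Q c z →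
          ∀ {u} → u ∈ˡ Q → c (y +ℤ u) ≡ c (z +ℤ u)
block-≡ Q c y z eq u∈ with Any.index u∈ | lookup-index u∈
... | i | refl = trans (sym (finToFun-funToFin (λ j → c (y +ℤ lookupˡ Q j)) i))
  (trans (cong (λ b → finToFun b i) eq) (finToFun-funToFin (λ j → c (z +ℤ lookupˡ Q j)) i))

¬Unique-suc : ∀ {k} {v : Vec (Fin k) (suc k)} → ¬ Uniqueᵛ v
¬Unique-suc {k} {v} uniq with pigeonhole ℕ.≤-refl (lookup v)
... | i , j , i<j , eq = <⇒≢ᶠ i<j (lookup-injective uniq i j eq)

module Focusing (A : List Φ) (p : Φ) (vdw : ∀ Γ → VdW (concatMap (perturb p Γ) A)) (k N : ℕ) where

  module Step {r} (L₁ : List (ℤ × List ℕ⁺)) (L₂ : List (ℤ × Vec (List ℕ⁺) r))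
    (L₁-after : ∀ {x} → x ∈ˡ L₁ → After N (proj₂ x))
    (L₂-after : ∀ {x} → x ∈ˡ L₂ → ∀ i → After N (lookup (proj₂ x) i))
    (find : ∀ (c : ℤ → Fin k) →
      (∃[ x ] x ∈ˡ L₁ × Mono c A x) ⊎ (∃[ x ] x ∈ˡ L₂ × Focused c A x)) where

    Γ : List (List ℕ⁺)
    Γ = concatMap (toListᵛ ∘ proj₂) L₂

    -- A bound for `N` and for all elements of the old rays: a list after `M` can be appended to
    -- each of them.
    M : ℕ
    M = N + sum (map value (concat Γ))

    -- The positions whose colours must survive the move: the old focus and the points on its rays.
    points : ℤ × Vec (List ℕ⁺) r → List ℤ
    points (a , γs) = a ∷ cartesianProductWith (λ φ γ → a +ℤ φ γ) A (toListᵛ γs)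

    Q : List ℤ
    Q = concatMap points L₂

    L : List (ℤ × List ℕ⁺)
    L = proj₁ (vdw Γ (k ^ length Q) M)

    L-after : ∀ {x} → x ∈ˡ L → After M (proj₂ x)
    L-after = proj₁ (proj₂ (vdw Γ (k ^ length Q) M))

    -- Moving the focus to b + a − p β keeps the colours of the rays γ, lengthened to
    -- γ ++ β, and adds the ray β, which has the colour of the old focus b + a.
    extend : ℤ × List ℕ⁺ → ℤ × Vec (List ℕ⁺) r → ℤ × Vec (List ℕ⁺) (suc r)
    extend (b , β) (a , γs) = (b +ℤ a - p β) , β ∷ Vec.map (_++ β) γs

    L₂′ : List (ℤ × Vec (List ℕ⁺) (suc r))
    L₂′ = cartesianProductWith extend L L₂

    rays : ℤ × Vec (List ℕ⁺) (suc r) → List (ℤ × List ℕ⁺)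
    rays (a , βs) = map (a ,_) (toListᵛ βs)

    translate : ℤ × List ℕ⁺ → ℤ × List ℕ⁺ → ℤ × List ℕ⁺
    translate (b , _) (a , γ) = b +ℤ a , γ

    -- Two sources of monochromatic pairs: translates of old ones, and rays of the moved focus that
    -- turn out to share its colour.
    L₁′ : List (ℤ × List ℕ⁺)
    L₁′ = cartesianProductWith translate L L₁ ++ concatMap rays L₂′

    ∈Γ : ∀ {x} → x ∈ˡ L₂ → ∀ i → lookup (proj₂ x) i ∈ˡ Γ
    ∈Γ x∈ i = ∈-concat⁺′ (∈-toList⁺ (∈-lookup i _)) (∈-map⁺ (toListᵛ ∘ proj₂) x∈)

    Γ≤M : ∀ {γ} → γ ∈ˡ Γ → All (λ t → value t ≤ M) γ
    Γ≤M γ∈ = All.tabulate λ t∈ →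
      ℕ.≤-trans (∈⇒≤sum (∈-map⁺ value (∈-concat⁺′ t∈ γ∈))) (ℕ.m≤n+m _ N)

    L₂′-after : ∀ {x} → x ∈ˡ L₂′ → ∀ i → After N (lookup (proj₂ x) i)
    L₂′-after x∈ i with ∈-cartesianProductWith⁻ extend L L₂ x∈
    L₂′-after x∈ zero    | _ , _ , y∈ , _ , refl = After-weaken (ℕ.m≤m+n N _) (L-after y∈)
    L₂′-after x∈ (suc i) | (_ , β) , (_ , γs) , y∈ , z∈ , refl
      rewrite lookup-map i (_++ β) γs =
        After-++ (ℕ.m≤m+n N _) (L₂-after z∈ i) (Γ≤M (∈Γ z∈ i)) (L-after y∈)

    ∈-toList⇒lookup : ∀ {n} {P : List ℕ⁺ → Set} (v : Vec (List ℕ⁺) n) → (∀ i → P (lookup v i)) →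
                      ∀ {x} → x ∈ˡ toListᵛ v → P x
    ∈-toList⇒lookup (y ∷ v) h (here refl) = h zero
    ∈-toList⇒lookup (y ∷ v) h (there x∈)  = ∈-toList⇒lookup v (h ∘ suc) x∈

    L₁′-after : ∀ {x} → x ∈ˡ L₁′ → After N (proj₂ x)
    L₁′-after x∈ with ∈-++⁻ (cartesianProductWith translate L L₁) x∈
    ... | inj₁ x∈₁ with _ , _ , _ , z∈ , refl ← ∈-cartesianProductWith⁻ translate L L₁ x∈₁ =
      L₁-after z∈
    ... | inj₂ x∈₂ with ray , x∈ray , ray∈ ← ∈-concat⁻′ (map rays L₂′) x∈₂
                   with y , y∈ , refl ← ∈-map⁻ rays ray∈
                   with β , β∈ , refl ← ∈-map⁻ (proj₁ y ,_) x∈ray =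
      ∈-toList⇒lookup (proj₂ y) (L₂′-after y∈) β∈

    find′ : ∀ (c : ℤ → Fin k) →
      (∃[ x ] x ∈ˡ L₁′ × Mono c A x) ⊎ (∃[ x ] x ∈ˡ L₂′ × Focused c A x)
    find′ c with proj₂ (proj₂ (vdw Γ (k ^ length Q) M)) (block Q c)
    -- The block colour is constant on the perturbed pattern around `b`, so the old configuration is
    -- sought in the colouring translated by `b`.
    ... | (b , β) , b∈ , mono with find (λ z → c (b +ℤ z))
    ... | inj₁ ((a , γ) , a∈ , monoγ) = inj₁ ((b +ℤ a , γ) ,
      ∈-++⁺ˡ (∈-cartesianProductWith⁺ translate b∈ a∈) ,
      λ {φ} φ∈ → trans (cong c (ℤ.+-assoc b a (φ γ))) (monoγ φ∈))
    ... | inj₂ ((a , γs) , a∈ , cols , hues , uniq) = result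
      where
      y : ℤ × Vec (List ℕ⁺) (suc r)
      y = extend (b , β) (a , γs)

      y∈ : y ∈ˡ L₂′
      y∈ = ∈-cartesianProductWith⁺ extend b∈ a∈

      hues′ : ∀ i {φ} → φ ∈ˡ A → c (proj₁ y +ℤ φ (lookup (proj₂ y) i)) ≡ lookup (c (b +ℤ a) ∷ cols) i
      hues′ zero {φ} φ∈ = trans (cong c (lemma a b (p β) (φ β)))
        (block-≡ Q c (b +ℤ (φ β - p β)) b (mono (∈-concat⁺′ (here refl) (∈-map⁺ (perturb p Γ) φ∈)))
          (∈-concat⁺′ (here refl) (∈-map⁺ points a∈)))
        where
        lemma : ∀ a b s t → b +ℤ a - s +ℤ t ≡ b +ℤ (t - s) +ℤ a
        lemma = solve 4 (λ a b s t → b :+ a :- s :+ t := b :+ (t :- s) :+ a) refl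
      -- The point on the lengthened ray is the old point `a + φ γ`, displaced by `b` plus a value
      -- of the perturbed system; the block colour does not see that value.
      hues′ (suc i) {φ} φ∈ rewrite lookup-map i (_++ β) γs =
        trans (cong c (lemma a b (p β) (φ (lookup γs i ++ β)) (φ (lookup γs i))))
        (trans (block-≡ Q c (b +ℤ (φ (lookup γs i ++ β) - φ (lookup γs i) - p β)) b
          (mono (∈-concat⁺′ (there (∈-map⁺ _ (∈Γ a∈ i))) (∈-map⁺ (perturb p Γ) φ∈)))
          (∈-concat⁺′ (there (∈-cartesianProductWith⁺ _ φ∈ (∈-toList⁺ (∈-lookup i γs)))) (∈-map⁺ points a∈)))
        (hues i φ∈))
        where
        lemma : ∀ a b s t u → b +ℤ a - s +ℤ t ≡ b +ℤ (t - u - s) +ℤ (a +ℤ u)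
        lemma = solve 5 (λ a b s t u → b :+ a :- s :+ t := b :+ (t :- u :- s) :+ (a :+ u)) refl

      result : (∃[ x ] x ∈ˡ L₁′ × Mono c A x) ⊎ (∃[ x ] x ∈ˡ L₂′ × Focused c A x)
      -- Either the moved focus has a new colour and there is one ray more, or it has the colour of
      -- some ray, which is then monochromatic together with it.
      result with any? (λ i → c (proj₁ y) ≟ᶠ lookup (c (b +ℤ a) ∷ cols) i)
      ... | no new = inj₂ (y , y∈ , c (b +ℤ a) ∷ cols , hues′ ,
        VAll.lookup⁻ (λ i eq → new (i , eq)) VAllPairs.∷ uniq)
      ... | yes (i , old) = inj₁ ((proj₁ y , lookup (proj₂ y) i) ,
        ∈-++⁺ʳ (cartesianProductWith translate L L₁)
          (∈-concat⁺′ (∈-map⁺ (proj₁ y ,_) (∈-toList⁺ (∈-lookup i (proj₂ y)))) (∈-map⁺ rays y∈)) ,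
        λ φ∈ → trans (hues′ i φ∈) (sym old))

  focus : ∀ r → MonoOrFocused A k N r
  focus zero = [] , (0ℤ , []) ∷ [] , (λ ()) , (λ { (here refl) () ; (there ()) }) ,
    λ c → inj₂ (_ , here refl , [] , (λ ()) , VAll.[] VAllPairs.∷ VAllPairs.[])
  focus (suc r) with focus r
  ... | L₁ , L₂ , L₁-after , L₂-after , find =
    S.L₁′ , S.L₂′ , S.L₁′-after , S.L₂′-after , S.find′
    where module S = Step L₁ L₂ L₁-after L₂-after find

  conclusion : Σ[ L ∈ List (ℤ × List ℕ⁺) ]
    (∀ {x} → x ∈ˡ L → After N (proj₂ x)) ×
    (∀ (c : ℤ → Fin k) → ∃[ x ] x ∈ˡ L × Mono c A x)
  -- With `k` rays, the focus and its rays would need `suc k` distinct colours, so only the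
  -- monochromatic alternative is left.
  conclusion with focus k
  ... | L₁ , L₂ , L₁-after , _ , find = L₁ , L₁-after , λ c → search c (find c)
    where
    search : ∀ c → _ → _
    search c (inj₁ found) = found
    search c (inj₂ (_ , _ , _ , _ , uniq)) = ⊥-elim (¬Unique-suc uniq)

vdw-step : ∀ A p → (∀ Γ → VdW (concatMap (perturb p Γ) A)) → VdW A
vdw-step A p vdw k N = Focusing.conclusion A p vdw k N

-- PET induction

VdW-⊆ : ∀ {A B} → A ⊆ˡ B → VdW B → VdW A
VdW-⊆ A⊆B vdw k N with vdw k N
... | L , L-after , find = L , L-after , λ c → let x , x∈ , mono = find c in x , x∈ , mono ∘ A⊆B

VdW-[] : VdW []
VdW-[] k N = (0ℤ , pos (suc N) ∷ []) ∷ [] ,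
  (λ { (here refl) → after (λ ()) ([] ∷ []) (ℕ.n<1+n N ∷ []) }) ,
  λ c → _ , here refl , λ ()

VdW-zeros : ∀ {A B} → All (Deg 0) B → VdW A → VdW (A ++ B)
VdW-zeros {A} {B} zeros vdw k N with vdw k N
... | L , L-after , find = L , L-after , find′
  where
  find′ : ∀ (c : ℤ → Fin k) → ∃[ x ] x ∈ˡ L × Mono c (A ++ B) x
  find′ c with find c
  ... | (a , β) , x∈ , mono = (a , β) , x∈ , mono′
    where
    mono′ : Mono c (A ++ B) (a , β)
    mono′ φ∈ with ∈-++⁻ A φ∈
    ... | inj₁ φ∈A = mono φ∈A
    ... | inj₂ φ∈B with All.lookup zeros φ∈B
    ...   | deg-zero φ≡0 = cong c (trans (cong (a +ℤ_) (φ≡0 β)) (ℤ.+-identityʳ a))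

-- The increment of `φ` along `γ` differs from `φ` by `Δ γ φ`, which has degree `d`. So modulo
-- degree `d` perturbing only subtracts `p`.
perturb-Deg : ∀ {d} (φ p ξ : Φ) Γ → Deg (suc d) φ → Deg d (λ l → φ l - p l - ξ l) →
              All (λ q → Deg d (λ l → q l - ξ l)) (perturb p Γ φ)
perturb-Deg {d} φ p ξ Γ (deg-suc a) b = b ∷ All.map⁺ {P = λ q → Deg d (λ l → q l - ξ l)} (All.universal (λ γ →
  Deg-resp (λ l → lemma (φ (γ ++ l)) (φ l) (φ γ) (p l) (ξ l)) (Deg-+ (a γ) b)) Γ)
  where
  lemma : ∀ x y z u v → (x - y - z) +ℤ (y - u - v) ≡ x - z - u - v
  lemma = solve 5 (λ x y z u v → (x :- y :- z) :+ (y :- u :- v) := x :- z :- u :- v) refl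

-- `Ψ` lists representatives of classes modulo degree `d`; its length is the inner induction
-- parameter.
Near : ∀ {n} → ℕ → Vec Φ n → Pred Φ 0ℓ
Near d Ψ φ = VAny.Any (λ ψ → Deg d (λ l → φ l - ψ l)) Ψ

Near⇒Deg : ∀ {n d} φ {Ψ : Vec Φ n} → VAll.All (Deg (suc d)) Ψ → Near d Ψ φ → Deg (suc d) φ
Near⇒Deg φ {ψ ∷ _} (b VAll.∷ _) (VAny.here a) =
  Deg-resp (λ l → lemma (φ l) (ψ l)) (Deg-+ (Deg-suc a) b)
  where
  lemma : ∀ x y → (x - y) +ℤ y ≡ x
  lemma = solve 2 (λ x y → (x :- y) :+ y := x) refl
Near⇒Deg φ (_ VAll.∷ bs) (VAny.there a) = Near⇒Deg φ bs a

concatMap-All : ∀ {P Q : Pred Φ 0ℓ} {f : Φ → List Φ} → (∀ φ → P φ → All Q (f φ)) →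
                ∀ {A} → All P A → All Q (concatMap f A)
concatMap-All h pA = All.concat⁺ (All.map⁺ (All.map (λ {φ} → h φ) pA))

split : ∀ {P Q : Pred Φ 0ℓ} {A} → All (λ φ → P φ ⊎ Q φ) A →
        Σ[ E ∈ List Φ ] Σ[ F ∈ List Φ ] All P E × All Q F × A ⊆ˡ E ++ F
split [] = [] , [] , [] , [] , λ ()
split {A = φ ∷ A} (inj₁ p ∷ pq) with split pq
... | E , F , pE , qF , A⊆ = φ ∷ E , F , p ∷ pE , qF ,
  λ { (here refl) → here refl ; (there x∈) → there (A⊆ x∈) }
split {A = φ ∷ A} (inj₂ q ∷ pq) with split pq
... | E , F , pE , qF , A⊆ = E , φ ∷ F , pE , q ∷ qF ,
  λ { (here refl) → ∈-++⁺ʳ E (here refl) ; (there x∈) → ++⁺ {xs = E} (λ x → x) there (A⊆ x∈) }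

-- 𝒞 stands for the part of the system of degree above d.  Perturbing
-- by a representative ψ of a class of degree suc d modulo degree d removes that
-- class and creates only new functions of degree d.
pet : ∀ d (𝒞 : Pred (List Φ) 0ℓ) → (∀ {C} → 𝒞 C → VdW C) →
      (∀ {C p} Γ → 𝒞 C → Deg d p → 𝒞 (concatMap (perturb p Γ) C)) →
      ∀ {C B} → 𝒞 C → All (Deg d) B → VdW (C ++ B)
pet zero    𝒞 vdw closed c∈ zeros = VdW-zeros zeros (vdw c∈)
pet (suc d) 𝒞 vdw closed {C} {B} c∈ degs =
  subst VdW (++-identityʳ (C ++ B)) (classes (Vec.fromList B) (VAll.fromList⁺ degs) c∈ near [])
  where
  near : All (Near d (Vec.fromList B)) B
  near = All.tabulate λ φ∈ → VAny.fromList⁺ (Any.map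
    (λ { {φ} refl → Deg-mono z≤n (deg-zero λ l → ℤ.+-inverseʳ (φ l)) }) φ∈)

  -- Seen from degree `d`, the functions whose classes are listed in `Ψ` join the part above.
  𝒟 : ∀ {n} → Vec Φ n → Pred (List Φ) 0ℓ
  𝒟 Ψ A = Σ[ C ∈ List Φ ] Σ[ E ∈ List Φ ] 𝒞 C × All (Near d Ψ) E × A ≡ C ++ E

  𝒟-closed : ∀ {n} (Ψ : Vec Φ n) → VAll.All (Deg (suc d)) Ψ →
             ∀ {A p} Γ → 𝒟 Ψ A → Deg d p → 𝒟 Ψ (concatMap (perturb p Γ) A)
  𝒟-closed Ψ degΨ {p = p} Γ (C , E , c∈ , nearE , refl) degp =
    _ , _ , closed Γ c∈ (Deg-suc degp) , concatMap-All (perturb-Near degΨ) nearE ,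
    concatMap-++ (perturb p Γ) C E
    where
    lemma : ∀ x y z → (x - z) - y ≡ x - y - z
    lemma = solve 3 (λ x y z → (x :- z) :- y := x :- y :- z) refl
    perturb-Near : ∀ {n} {Ψ : Vec Φ n} → VAll.All (Deg (suc d)) Ψ →
                   ∀ φ → Near d Ψ φ → All (Near d Ψ) (perturb p Γ φ)
    perturb-Near degΨ φ ν@(VAny.here {x = ψ} a) = All.map VAny.here
      (perturb-Deg φ p ψ Γ (Near⇒Deg φ degΨ ν)
        (Deg-resp (λ l → lemma (φ l) (p l) (ψ l)) (Deg-- a degp)))
    perturb-Near (_ VAll.∷ degΨ) φ (VAny.there ν) = All.map VAny.there (perturb-Near degΨ φ ν)

  classes : ∀ {n} (Ψ : Vec Φ n) → VAll.All (Deg (suc d)) Ψ → ∀ {C E F} → 𝒞 C →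
            All (Near d Ψ) E → All (Deg d) F → VdW ((C ++ E) ++ F)
  𝒟-VdW : ∀ {n} (Ψ : Vec Φ n) → VAll.All (Deg (suc d)) Ψ → ∀ {A} → 𝒟 Ψ A → VdW A

  -- `pet` at the smaller degree disposes of `F`, with `𝒟 Ψ` as the part above; `𝒟-VdW` then uses up
  -- the classes in `Ψ` one at a time.
  classes Ψ degΨ c∈ nearE degF =
    pet d (𝒟 Ψ) (𝒟-VdW Ψ degΨ) (𝒟-closed Ψ degΨ) (_ , _ , c∈ , nearE , refl) degF

  𝒟-VdW []      _    (C , []     , c∈ , _      , refl) = subst VdW (sym (++-identityʳ C)) (vdw c∈)
  𝒟-VdW []      _    (C , _ ∷ _  , c∈ , () ∷ _ , refl)
  𝒟-VdW {suc n} (ψ ∷ Ψ) (degψ VAll.∷ degΨ) (C , E , c∈ , nearE , refl) = vdw-step (C ++ E) ψ step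
    where
    -- Perturbing by `ψ` translates every other class by `- ψ` and sends the class of `ψ` into
    -- degree `d`, so one class fewer remains.
    Ψ′ : Vec Φ n
    Ψ′ = Vec.map (λ ξ l → ξ l - ψ l) Ψ

    sub-zero : ∀ x → x - 0ℤ ≡ x
    sub-zero = solve 1 (λ x → x :- con 0ℤ := x) refl

    cancel : ∀ x y z → x - z ≡ x - y - (z - y)
    cancel = solve 3 (λ x y z → x :- z := x :- y :- (z :- y)) refl

    rest : ∀ Γ {m} {Ξ : Vec Φ m} φ → Deg (suc d) φ → Near d Ξ φ →
           All (Near d (Vec.map (λ ξ l → ξ l - ψ l) Ξ)) (perturb ψ Γ φ)
    rest Γ φ degφ (VAny.here {x = ξ} a) = All.map VAny.here
      (perturb-Deg φ ψ (λ l → ξ l - ψ l) Γ degφ (Deg-resp (λ l → cancel (φ l) (ψ l) (ξ l)) a))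
    rest Γ φ degφ (VAny.there ν) = All.map VAny.there (rest Γ φ degφ ν)

    classify : ∀ Γ φ → Near d (ψ ∷ Ψ) φ →
           All (λ q → Near d Ψ′ q ⊎ Deg d q) (perturb ψ Γ φ)
    classify Γ φ ν@(VAny.here a) = All.map (λ {q} b → inj₂ (Deg-resp (λ l → sub-zero (q l)) b))
      (perturb-Deg φ ψ (λ _ → 0ℤ) Γ (Near⇒Deg φ (degψ VAll.∷ degΨ) ν)
        (Deg-resp (λ l → sym (sub-zero (φ l - ψ l))) a))
    classify Γ φ (VAny.there ν) = All.map inj₁ (rest Γ φ (Near⇒Deg φ degΨ ν) ν)

    step : ∀ Γ → VdW (concatMap (perturb ψ Γ) (C ++ E))
    step Γ with split (concatMap-All (classify Γ) nearE)
    ... | E′ , F′ , nearE′ , degF′ , E⊆ = VdW-⊆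
      (subst₂ _⊆ˡ_ (sym (concatMap-++ (perturb ψ Γ) C E)) (sym (++-assoc (concatMap (perturb ψ Γ) C) E′ F′))
        (++⁺ (λ x∈ → x∈) E⊆))
      (classes Ψ′ (VAll.map⁺ (VAll.map (λ {ξ} b → Deg-- {φ = ξ} b degψ) degΨ)) (closed Γ c∈ degψ) nearE′ degF′)

abstract
  -- Nothing lies above the degree bound, so `pet` starts with the empty system as the only member
  -- of `𝒞`.
  Deg⇒VdW : ∀ {d B} → All (Deg d) B → VdW B
  Deg⇒VdW {d} = pet d (_≡ []) (λ { refl → VdW-[] }) (λ { Γ refl _ → refl }) refl

-- Members of minimal idempotents

value-injective : ∀ {m n} → value m ≡ value n → m ≡ n
value-injective {pos m} {pos .m} refl = refl

1≤value : ∀ n → 1 ≤ value n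
1≤value (pos (suc n)) = s≤s z≤n

+⁺-assoc : ∀ x y z → (x +⁺ y) +⁺ z ≡ x +⁺ (y +⁺ z)
+⁺-assoc x y z = value-injective (ℕ.+-assoc (value x) (value y) (value z))

-- Junk value 1⁺ on the integers that are not positive.
toℕ⁺ : ℤ → ℕ⁺
toℕ⁺ +[1+ n ] = pos (suc n)
toℕ⁺ _        = 1⁺

value-toℕ⁺ : ∀ {z n} → z ≡ + value n → toℕ⁺ z ≡ n
value-toℕ⁺ {n = pos (suc n)} refl = refl

shift-positive : ∀ u M → ∣ u ∣ ≤ M → + value (toℕ⁺ (u +ℤ + suc M)) ≡ u +ℤ + suc M
shift-positive (+ n)      M _ rewrite ℕ.+-suc n M = refl
shift-positive (-[1+ n ]) M n<M rewrite ℤ.⊖-≥ (ℕ.m≤n⇒m≤1+n n<M) | ℕ.+-∸-assoc 1 n<M = refl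

After⇒𝒫f : ∀ {N β} → After N β → 𝒫f ℕ⁺
After⇒𝒫f {β = []}    (after ne _ _)  = ⊥-elim (ne refl)
After⇒𝒫f {β = t ∷ β} (after _ inc _) = record
  { elements = t ∷ β
  ; unique   = AllPairs.map (λ s<t s≡t → ℕ.<⇒≢ s<t (cong value s≡t)) inc
  }

toList-After : ∀ {N β} (aβ : After N β) → toList (After⇒𝒫f aβ) ≡ β
toList-After {β = []}    (after ne _ _) = ⊥-elim (ne refl)
toList-After {β = t ∷ β} (after _ _ _)  = refl

abstract
  -- The candidates of `VdW` are fixed before the colouring. Hence one translation by `suc M` makes
  -- all their points positive, and a colouring of `ℕ⁺` can be pulled back to `ℤ` along `toℕ⁺`.
  polynomial-vdW : ∀ {k} (F : List ℙ) (H : List ℕ⁺^ℕ⁺) (c : ℕ⁺ → Fin k) →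
    ∃[ b ] Σ[ β ∈ 𝒫f ℕ⁺ ] ∃[ col ] (∀ {P f} → P ∈ˡ F → f ∈ˡ H →
      ∃[ y ] + value y ≡ + value b +ℤ eval P (+ ∑ β (value ∘ f)) × c y ≡ col)
  polynomial-vdW {k} F H c with Deg⇒VdW degs k 0
    where
    linear : ℕ⁺^ℕ⁺ → Φ
    linear f l = + sum (map (value ∘ f) l)

    linear-additive : ∀ f → Additive (linear f)
    linear-additive f γ l = cong +_ (trans (cong sum (map-++ (value ∘ f) γ l)) (sum-++ (map (value ∘ f) γ) _))

    system : List Φ
    system = cartesianProductWith (λ P f l → eval P (linear f l)) F H

    degs : All (Deg (sum (map length F))) system
    degs = All.tabulate λ φ∈ → case φ∈
      where
      case : ∀ {φ} → φ ∈ˡ system → Deg (sum (map length F)) φ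
      case φ∈ with P , f , P∈ , f∈ , refl ← ∈-cartesianProductWith⁻ (λ P f l → eval P (linear f l)) F H φ∈ =
        Deg-mono (∈⇒≤sum (∈-map⁺ length P∈)) (eval-Deg P (linear f) (linear-additive f))
  ... | L , L-after , find = result
    where
    system : List Φ
    system = cartesianProductWith (λ P f l → eval P (+ sum (map (value ∘ f) l))) F H

    points : ℤ × List ℕ⁺ → List ℤ
    points (a , β) = a ∷ map (λ φ → a +ℤ φ β) system

    M : ℕ
    M = sum (map ∣_∣ (concatMap points L))

    positive : ∀ {x} u → x ∈ˡ L → u ∈ˡ points x → + value (toℕ⁺ (u +ℤ + suc M)) ≡ u +ℤ + suc M
    positive u x∈ u∈ = shift-positive u M (∈⇒≤sum (∈-map⁺ ∣_∣ (∈-concat⁺′ u∈ (∈-map⁺ points x∈))))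

    result : ∃[ b ] Σ[ β ∈ 𝒫f ℕ⁺ ] ∃[ col ] (∀ {P f} → P ∈ˡ F → f ∈ˡ H →
      ∃[ y ] + value y ≡ + value b +ℤ eval P (+ ∑ β (value ∘ f)) × c y ≡ col)
    result with find (λ z → c (toℕ⁺ (z +ℤ + suc M)))
    ... | (a , β) , x∈ , mono =
      toℕ⁺ (a +ℤ + suc M) , After⇒𝒫f (L-after {a , β} x∈) , _ , λ {P} {f} P∈ f∈ →
        let φβ = eval P (+ sum (map (value ∘ f) β))
            φ∈ = ∈-cartesianProductWith⁺ (λ P f l → eval P (+ sum (map (value ∘ f) l))) P∈ f∈
        in toℕ⁺ (a +ℤ φβ +ℤ + suc M) ,
           (begin
             + value (toℕ⁺ (a +ℤ φβ +ℤ + suc M))      ≡⟨ positive {a , β} (a +ℤ φβ) x∈ (there (∈-map⁺ (λ φ → a +ℤ φ β) φ∈)) ⟩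
             a +ℤ φβ +ℤ + suc M                        ≡⟨ lemma a φβ (+ suc M) ⟩
             (a +ℤ + suc M) +ℤ φβ
               ≡⟨ cong₂ _+ℤ_ (sym (positive {a , β} a x∈ (here refl)))
                    (cong (λ l → eval P (+ sum (map (value ∘ f) l))) (sym (toList-After (L-after {a , β} x∈)))) ⟩
             + value (toℕ⁺ (a +ℤ + suc M)) +ℤ eval P (+ ∑ (After⇒𝒫f (L-after {a , β} x∈)) (value ∘ f)) ∎) ,
           mono φ∈
      where
      open ≡-Reasoning
      lemma : ∀ x y z → x +ℤ y +ℤ z ≡ x +ℤ z +ℤ y
      lemma = solve 3 (λ x y z → x :+ y :+ z := x :+ z :+ y) refl

-- Ultrafilters, minimal left ideals and syndetic sets

module _ {X : Set} (p : Ultrafilter X) where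
  private module P = Ultrafilter p

  ⋂-∈ : ∀ {I : Set} (is : List I) (S : I → Pred X 0ℓ) →
        (∀ {i} → i ∈ˡ is → S i ∈ Sets p) → (λ x → ∀ {i} → i ∈ˡ is → S i x) ∈ Sets p
  ⋂-∈ []       S S∈ = P.upward (λ _ ()) P.full
  ⋂-∈ (i ∷ is) S S∈ = P.upward (λ { (Si , Sis) (here refl) → Si ; (Si , Sis) (there i∈) → Sis i∈ })
    (P.inter (S∈ (here refl)) (⋂-∈ is S (S∈ ∘ there)))

-- Adding any element of `ℕ⁺` raises a number by at least one, so a tail in `p` puts the next tail
-- in `p ⊕ p`, hence in `p`.
idempotent⇒≥ : ∀ p → Idempotent p → ∀ n → (λ x → n ≤ value x) ∈ Sets p
idempotent⇒≥ p idem zero    = P.upward (λ _ → z≤n) P.full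
  where module P = Ultrafilter p
idempotent⇒≥ p idem (suc n) = proj₁ idem (P.upward
  (λ {x} n≤x → P.upward (λ {y} _ → subst (_≤ value x + value y) (ℕ.+-comm n 1)
    (ℕ.+-mono-≤ n≤x (1≤value y))) P.full)
  (idempotent⇒≥ p idem n))
  where module P = Ultrafilter p

⊕-assoc : ∀ p q r → (p ⊕ q) ⊕ r ≈ p ⊕ (q ⊕ r)
⊕-assoc p q r =
  (λ {A} → P.upward λ {x} → Q.upward λ {y} → R.upward λ {z} → subst A (+⁺-assoc x y z)) ,
  (λ {A} → P.upward λ {x} → Q.upward λ {y} → R.upward λ {z} → subst A (sym (+⁺-assoc x y z)))
  where
  module P = Ultrafilter p
  module Q = Ultrafilter q
  module R = Ultrafilter r

≈-sym : ∀ (p q : βℕ) → p ≈ q → q ≈ p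
≈-sym p q (p⊆q , q⊆p) = q⊆p , p⊆q

≈-trans : ∀ (p q r : βℕ) → p ≈ q → q ≈ r → p ≈ r
≈-trans p q r (p⊆q , q⊆p) (q⊆r , r⊆q) = (λ {A} a → q⊆r {A} (p⊆q {A} a)) , (λ {A} a → q⊆p {A} (r⊆q {A} a))

⊕-congˡ : ∀ p q r → q ≈ r → p ⊕ q ≈ p ⊕ r
⊕-congˡ p q r (q⊆r , r⊆q) = (λ {A} → P.upward λ {x} → q⊆r {λ y → A (x +⁺ y)}) ,
                         (λ {A} → P.upward λ {x} → r⊆q {λ y → A (x +⁺ y)})
  where module P = Ultrafilter p

-- The ultrafilters `s ⊕ (r ⊕ p)` form a left ideal inside `L`, so minimality puts `p` among them.
minimal⇒absorbing : ∀ {p} → p ∈ K[βℕ] → ∀ r → ∃[ s ] p ≈ s ⊕ (r ⊕ p)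
minimal⇒absorbing {p} (L , (L-ideal , L-minimal) , p∈L) r = L-minimal L′ L′-ideal L′⊆L p∈L
  where
  module L = LeftIdeal L-ideal
  L′ : Pred βℕ (lsuc 0ℓ)
  L′ q = ∃[ s ] q ≈ s ⊕ (r ⊕ p)
  L′⊆L : ∀ {q} → q ∈ L′ → q ∈ L
  L′⊆L {q} (s , q≈) = L.respects {s ⊕ (r ⊕ p)} {q} (≈-sym q (s ⊕ (r ⊕ p)) q≈) (L.absorbs s (L.absorbs r p∈L))
  L′-ideal : LeftIdeal L′
  L′-ideal = record
    { nonempty = r ⊕ (r ⊕ p) , r , (λ a → a) , (λ a → a)
    ; respects = λ { {q} {q′} q≈q′ (s , q≈) →
        s , ≈-trans q′ q (s ⊕ (r ⊕ p)) (≈-sym q q′ q≈q′) q≈ }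
    ; absorbs  = λ { q {q′} (s , q′≈) → q ⊕ s ,
        ≈-trans (q ⊕ q′) (q ⊕ (s ⊕ (r ⊕ p))) ((q ⊕ s) ⊕ (r ⊕ p)) (⊕-congˡ q q′ (s ⊕ (r ⊕ p)) q′≈)
          (≈-sym ((q ⊕ s) ⊕ (r ⊕ p)) (q ⊕ (s ⊕ (r ⊕ p))) (⊕-assoc q s (r ⊕ p))) }
    }

module Minimal (em : ∀ {ℓ} → ExcludedMiddle ℓ) where

  nonempty : ∀ {X} (p : Ultrafilter X) {A} → A ∈ Sets p → ∃[ x ] A x
  nonempty p {A} A∈ with em {P = ∃[ x ] A x}
  ... | yes a = a
  ... | no ¬a = ⊥-elim (P.proper (P.upward (λ a → ¬a (_ , a)) A∈))
    where module P = Ultrafilter p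

  -- If no finite set of shifts covered ℕ⁺, let a n avoid the first n of them: the
  -- image r of p under a would violate p ≈ s ⊕ (r ⊕ p).
  syndetic : ∀ {p} → MinimalIdempotent p → ∀ {A} → A ∈ Sets p →
    ∃[ N ] ∀ y → ∃[ x ] value x ≤ N × (λ z → A (x +⁺ (y +⁺ z))) ∈ Sets p
  syndetic {p} (idem , p∈K) {A} A∈ = decide em
    where
    module P = Ultrafilter p

    B : ℕ⁺ → ℕ⁺ → Set
    B x y = (λ z → A (x +⁺ (y +⁺ z))) ∈ Sets p

    Goal : Set
    Goal = ∃[ N ] ∀ y → ∃[ x ] value x ≤ N × B x y

    avoid : ¬ Goal → ∀ n → ∃[ y ] ∀ x → value x ≤ n → ¬ B x y
    avoid ¬goal n with em {P = ∃[ y ] ∀ x → value x ≤ n → ¬ B x y}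
    ... | yes y = y
    ... | no ¬y = ⊥-elim (¬goal (n , cover))
      where
      cover : ∀ y → ∃[ x ] value x ≤ n × B x y
      cover y with em {P = ∃[ x ] value x ≤ n × B x y}
      ... | yes x = x
      ... | no ¬x = ⊥-elim (¬y (y , λ x x≤n b → ¬x (x , x≤n , b)))

    decide : _ → Goal
    decide (yes goal) = goal
    decide (no ¬goal) = ⊥-elim contra
      where
      a : ℕ⁺ → ℕ⁺
      a n = proj₁ (avoid ¬goal (value n))
      contra : ⊥
      contra with minimal⇒absorbing p∈K (mapᵘ a p)
      ... | s , p≈ with nonempty s (proj₁ p≈ A∈)
      ... | x , x∈ with nonempty p (P.inter x∈ (idempotent⇒≥ p idem (value x)))
      ... | n , b , x≤n = proj₂ (avoid ¬goal (value n)) x x≤n b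

  minimal⇒𝒥ₚ : ∀ {p} → MinimalIdempotent p → p ∈ 𝒥ₚ
  minimal⇒𝒥ₚ {p} min A A∈ F H with syndetic min A∈
  ... | N , cover = result
    where
    x : ℕ⁺ → ℕ⁺
    x y = proj₁ (cover y)

    x<sN : ∀ y → value (x y) < suc N
    x<sN y = s≤s (proj₁ (proj₂ (cover y)))

    color : ℕ⁺ → Fin (suc N)
    color y = fromℕ< (x<sN y)

    same : ∀ {y y′ col} → color y ≡ col → color y′ ≡ col → x y ≡ x y′
    same {y} {y′} eq eq′ = value-injective (trans (sym (toℕ-fromℕ< (x<sN y)))
      (trans (cong toℕ (trans eq (sym eq′))) (toℕ-fromℕ< (x<sN y′))))

    result : Σ[ a ∈ ℕ⁺ ] Σ[ β ∈ 𝒫f ℕ⁺ ] (∀ P f → P ∈ᶠ F → f ∈ᶠ H →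
      (+ value a +ℤ eval P (+ ∑ β (value ∘ f))) ∈ℤ A)
    result with polynomial-vdW (toList F) (toList H) color
    -- `F` and `H` are nonempty, so the pattern has a point `y₀`. Its shift `x₀` serves every other
    -- point, the colours being equal, and `z` is then taken from the intersection of finitely many
    -- members of `p`.
    ... | b , β , col , mono with mono {head (elements F)} {head (elements H)} (here refl) (here refl)
    ... | y₀ , _ , col₀ = x₀ +⁺ (b +⁺ z) , β , λ P f P∈ f∈ →
      let y , y≡ , a = z∈ (∈-cartesianProduct⁺ P∈ f∈)
      in x₀ +⁺ (y +⁺ z) , trans
        (cong (λ u → + value x₀ +ℤ (u +ℤ + value z)) y≡)
        (lemma (+ value x₀) (+ value b) (eval P (+ ∑ β (value ∘ f))) (+ value z)) , a
      where
      x₀ : ℕ⁺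
      x₀ = x y₀

      S : ℙ × ℕ⁺^ℕ⁺ → Pred ℕ⁺ 0ℓ
      S (P , f) z = ∃[ y ] + value y ≡ + value b +ℤ eval P (+ ∑ β (value ∘ f)) × A (x₀ +⁺ (y +⁺ z))

      S∈ : ∀ {i} → i ∈ˡ cartesianProduct (toList F) (toList H) → S i ∈ Sets p
      S∈ {P , f} i∈ with ∈-cartesianProduct⁻ (toList F) (toList H) i∈
      ... | P∈ , f∈ with mono P∈ f∈
      ... | y , y≡ , coly = Ultrafilter.upward p (λ a → y , y≡ , a)
        (subst (λ x → (λ z → A (x +⁺ (y +⁺ z))) ∈ Sets p) (same coly col₀) (proj₂ (proj₂ (cover y))))

      common : ∃[ z ] (∀ {i} → i ∈ˡ cartesianProduct (toList F) (toList H) → S i z)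
      common = nonempty p (⋂-∈ p _ S S∈)

      z : ℕ⁺
      z = proj₁ common

      z∈ : ∀ {i} → i ∈ˡ cartesianProduct (toList F) (toList H) → S i z
      z∈ = proj₂ common

      lemma : ∀ x b e z → x +ℤ (b +ℤ e +ℤ z) ≡ (x +ℤ (b +ℤ z)) +ℤ e
      lemma = solve 4 (λ x b e z → x :+ (b :+ e :+ z) := (x :+ (b :+ z)) :+ e) refl

-- Increments of polynomials and finite sets

infixl 6 _+ₚ_
_+ₚ_ : ℙ → ℙ → ℙ
[]       +ₚ Q        = Q
(c ∷ P)  +ₚ []       = c ∷ P
(c ∷ P)  +ₚ (d ∷ Q)  = (c +ℤ d) ∷ (P +ₚ Q)

eval-+ₚ : ∀ P Q x → eval (P +ₚ Q) x ≡ eval P x +ℤ eval Q x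
eval-+ₚ []      Q       x = sym (ℤ.+-identityˡ (eval Q x))
eval-+ₚ (c ∷ P) []      x = sym (ℤ.+-identityʳ (eval (c ∷ P) x))
eval-+ₚ (c ∷ P) (d ∷ Q) x = trans (cong (λ e → (c +ℤ d +ℤ e) *ℤ x) (eval-+ₚ P Q x))
  (lemma c d (eval P x) (eval Q x) x)
  where
  lemma : ∀ c d p q x → (c +ℤ d +ℤ (p +ℤ q)) *ℤ x ≡ (c +ℤ p) *ℤ x +ℤ (d +ℤ q) *ℤ x
  lemma = solve 5 (λ c d p q x → (c :+ d :+ (p :+ q)) :* x := (c :+ p) :* x :+ (d :+ q) :* x) refl

eval-map-* : ∀ s P x → eval (map (s *ℤ_) P) x ≡ s *ℤ eval P x
eval-map-* s []      x = sym (ℤ.*-zeroʳ s)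
eval-map-* s (c ∷ P) x = trans (cong (λ e → (s *ℤ c +ℤ e) *ℤ x) (eval-map-* s P x))
  (lemma s c (eval P x) x)
  where
  lemma : ∀ s c p x → (s *ℤ c +ℤ s *ℤ p) *ℤ x ≡ s *ℤ ((c +ℤ p) *ℤ x)
  lemma = solve 4 (λ s c p x → (s :* c :+ s :* p) :* x := s :* ((c :+ p) :* x)) refl

-- Write the polynomial as `(c + P) x` and let `R` be the increment of `P`. The increment of the
-- whole is `s R x + (c + P s + R x) x`, again without constant term.
increment : ℙ → ℤ → ℙ
increment []      s = []
increment (c ∷ P) s = map (s *ℤ_) (increment P s) +ₚ ((c +ℤ eval P s) ∷ increment P s)

eval-increment : ∀ P s x → eval (increment P s) x ≡ eval P (s +ℤ x) - eval P s
eval-increment []      s x = refl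
eval-increment (c ∷ P) s x = begin
  eval (map (s *ℤ_) R +ₚ ((c +ℤ eval P s) ∷ R)) x
    ≡⟨ eval-+ₚ (map (s *ℤ_) R) ((c +ℤ eval P s) ∷ R) x ⟩
  eval (map (s *ℤ_) R) x +ℤ (c +ℤ eval P s +ℤ eval R x) *ℤ x
    ≡⟨ cong (_+ℤ (c +ℤ eval P s +ℤ eval R x) *ℤ x) (eval-map-* s R x) ⟩
  s *ℤ eval R x +ℤ (c +ℤ eval P s +ℤ eval R x) *ℤ x
    ≡⟨ cong (λ r → s *ℤ r +ℤ (c +ℤ eval P s +ℤ r) *ℤ x) (eval-increment P s x) ⟩
  s *ℤ (eval P (s +ℤ x) - eval P s) +ℤ (c +ℤ eval P s +ℤ (eval P (s +ℤ x) - eval P s)) *ℤ x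
    ≡⟨ lemma s c x (eval P (s +ℤ x)) (eval P s) ⟩
  (c +ℤ eval P (s +ℤ x)) *ℤ (s +ℤ x) - (c +ℤ eval P s) *ℤ s ∎
  where
  open ≡-Reasoning
  R : ℙ
  R = increment P s
  lemma : ∀ s c x u v → s *ℤ (u - v) +ℤ (c +ℤ v +ℤ (u - v)) *ℤ x
        ≡ (c +ℤ u) *ℤ (s +ℤ x) - (c +ℤ v) *ℤ s
  lemma = solve 5 (λ s c x u v → s :* (u :- v) :+ (c :+ v :+ (u :- v)) :* x
    := (c :+ u) :* (s :+ x) :- (c :+ v) :* s) refl

eval-0 : ∀ P → eval P 0ℤ ≡ 0ℤ
eval-0 []      = refl
eval-0 (c ∷ P) = ℤ.*-zeroʳ (c +ℤ eval P 0ℤ)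

∈⇒≤maxᶠ : ∀ {t} (β : 𝒫f ℕ⁺) → t ∈ᶠ β → value t ≤ maxᶠ β
∈⇒≤maxᶠ β t∈ = Extrema.v≤max⁺ (value (head (elements β))) (map value (tail (elements β))) (case t∈)
  where
  case : ∀ {t} → t ∈ᶠ β → value t ≤ value (head (elements β)) ⊎ Any (value t ≤_) (map value (tail (elements β)))
  case (here refl) = inj₁ ℕ.≤-refl
  case (there t∈)  = inj₂ (Any.map ℕ.≤-reflexive (∈-map⁺ value t∈))

minᶠ≤∈ : ∀ {t} (β : 𝒫f ℕ⁺) → t ∈ᶠ β → minᶠ β ≤ value t
minᶠ≤∈ β (here refl) = Extrema.min≤⊤ (value (head (elements β))) (map value (tail (elements β)))
minᶠ≤∈ β (there t∈)  = All.lookup (Extrema.min≤xs (value (head (elements β))) (map value (tail (elements β)))) (∈-map⁺ value t∈)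

<minᶠ : ∀ {N} (β : 𝒫f ℕ⁺) → (∀ {t} → t ∈ᶠ β → N < value t) → N < minᶠ β
<minᶠ β N< = Extrema.v<min⁺ (N< {head (elements β)} (here refl)) (All.map⁺ (All.tabulate λ t∈ → N< (there t∈)))

shiftᶠ : ℕ⁺ → 𝒫f ℕ⁺ → 𝒫f ℕ⁺
shiftᶠ N β = record
  { elements = List⁺.map (_+⁺ N) (elements β)
  ; unique   = Unique.map⁺ {f = _+⁺ N} (λ {s} {t} eq → value-injective
      (ℕ.+-cancelʳ-≡ (value N) (value s) (value t) (cong value eq))) (𝒫f.unique β)
  }

<minᶠ-shiftᶠ : ∀ N β → value N < minᶠ (shiftᶠ N β)
<minᶠ-shiftᶠ N β = <minᶠ (shiftᶠ N β) λ t∈ → case (∈-map⁻ (_+⁺ N) t∈)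
  where
  case : ∀ {t} → ∃[ s ] s ∈ᶠ β × t ≡ s +⁺ N → value N < value t
  case (s , _ , refl) = ℕ.+-monoˡ-≤ (value N) (1≤value s)

∑-shiftᶠ : ∀ N β (f : ℕ⁺ → ℕ) → ∑ β (λ t → f (t +⁺ N)) ≡ ∑ (shiftᶠ N β) f
∑-shiftᶠ N β f = cong sum (map-∘ (toList β))

Unique-⊆⇒length≤ : ∀ {X : Set} {xs ys : List X} → Unique xs → xs ⊆ˡ ys → length xs ≤ length ys
Unique-⊆⇒length≤ {xs = []}     _             _    = z≤n
Unique-⊆⇒length≤ {xs = x ∷ xs} (x∉ ∷ unique) xs⊆ys with ∈-∃++ (xs⊆ys (here refl))
... | as , bs , refl = subst (suc (length xs) ≤_) (sym length≡)
  (s≤s (Unique-⊆⇒length≤ unique xs⊆as++bs))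
  where
  length≡ : length (as ++ x ∷ bs) ≡ suc (length (as ++ bs))
  length≡ = trans (length-++ as) (trans (ℕ.+-suc (length as) (length bs)) (cong suc (sym (length-++ as))))
  xs⊆as++bs : xs ⊆ˡ as ++ bs
  xs⊆as++bs y∈ with ∈-++⁻ as (xs⊆ys (there y∈))
  ... | inj₁ y∈as          = ∈-++⁺ˡ y∈as
  ... | inj₂ (here refl)   = ⊥-elim (All.lookup x∉ y∈ refl)
  ... | inj₂ (there y∈bs)  = ∈-++⁺ʳ as y∈bs

powerset : ∀ {X : Set} → List X → List (List X)
powerset []       = [] ∷ []
powerset (x ∷ xs) = powerset xs ++ map (x ∷_) (powerset xs)

filter∈powerset : ∀ {X : Set} {P : Pred X 0ℓ} (P? : Decidable P) xs → filter P? xs ∈ˡ powerset xs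
filter∈powerset P? []       = here refl
filter∈powerset P? (x ∷ xs) with does (P? x)
... | true  = ∈-++⁺ʳ (powerset xs) (∈-map⁺ (x ∷_) (filter∈powerset P? xs))
... | false = ∈-++⁺ˡ (filter∈powerset P? xs)

-- Finite sets up to `_≋_` and their proper subsets

module Classical (em : ∀ {ℓ} → ExcludedMiddle ℓ) (ext : ∀ {a b} → Extensionality a b) where

  _≟_ : ∀ {X : Set} → DecidableEquality X
  x ≟ y = em

  fromList⁺ : ∀ {X : Set} → List⁺ X → 𝒫f X
  fromList⁺ (x ∷ xs) = record
    { elements = x ∷ filter (λ y → ¬? (x ≟ y)) (deduplicate _≟_ xs)
    ; unique   = deduplicate-! _≟_ (x ∷ xs)
    }

  ∈-fromList⁺⁺ : ∀ {X : Set} (xs : List⁺ X) {y} → y ∈ˡ List⁺.toList xs → y ∈ᶠ fromList⁺ xs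
  ∈-fromList⁺⁺ xs = ∈-deduplicate⁺ _≟_

  ∈-fromList⁺⁻ : ∀ {X : Set} (xs : List⁺ X) {y} → y ∈ᶠ fromList⁺ xs → y ∈ˡ List⁺.toList xs
  ∈-fromList⁺⁻ xs = ∈-deduplicate⁻ _≟_ (List⁺.toList xs)

  module _ {X : Set} where

    ≋-sym : ∀ {G K : 𝒫f X} → G ≋ K → K ≋ G
    ≋-sym (G⊆K , K⊆G) = K⊆G , G⊆K

    ≋-trans : ∀ {F G K : 𝒫f X} → F ≋ G → G ≋ K → F ≋ K
    ≋-trans (F⊆G , G⊆F) (G⊆K , K⊆G) = (λ x → G⊆K (F⊆G x)) , (λ x → G⊆F (K⊆G x))

    ⊊-trans : ∀ {F G K : 𝒫f X} → F ⊊ G → G ⊊ K → F ⊊ K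
    ⊊-trans (F⊆G , G⊈F) (G⊆K , K⊈G) = (λ x → G⊆K (F⊆G x)) , λ K⊆F → K⊈G (λ x → F⊆G (K⊆F x))

    ⊊-resp-≋ : ∀ {F G F′ G′ : 𝒫f X} → F ≋ F′ → G ≋ G′ → F ⊊ G → F′ ⊊ G′
    ⊊-resp-≋ (F⊆F′ , F′⊆F) (G⊆G′ , G′⊆G) (F⊆G , G⊈F) =
      (λ x → G⊆G′ (F⊆G (F′⊆F x))) , λ G′⊆F′ → G⊈F (λ x → F′⊆F (G′⊆F′ (G⊆G′ x)))

    rank : 𝒫f X → ℕ
    rank G = length (toList G)

    ⊊⇒rank< : ∀ {K G : 𝒫f X} → K ⊊ G → rank K < rank G
    ⊊⇒rank< {K} {G} (K⊆G , G⊈K) = ℕ.≰⇒> λ G≤K → G⊈K (covered G≤K)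
      where
      covered : rank G ≤ rank K → G ⊆ᶠ K
      covered G≤K {y} y∈G with em {P = y ∈ᶠ K}
      ... | yes y∈K = y∈K
      ... | no y∉K = ⊥-elim (ℕ.<⇒≱ (Unique-⊆⇒length≤ {xs = y ∷ toList K}
        (All.tabulate (λ { x∈ refl → y∉K x∈ }) ∷ 𝒫f.unique K)
        (λ { (here refl) → y∈G ; (there x∈) → K⊆G x∈ })) G≤K)

  module Canonical {X : Set} (default : 𝒫f X) where

    class : 𝒫f X → 𝒫f X → Bool
    class G K = does (em {P = K ≋ G})

    choose : (𝒫f X → Bool) → 𝒫f X
    choose χ with em {P = ∃[ K ] χ K ≡ true}
    ... | yes (K , _) = K
    ... | no _        = default

    choose-spec : ∀ (χ : 𝒫f X → Bool) {K} → χ K ≡ true → χ (choose χ) ≡ true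
    choose-spec χ χK with em {P = ∃[ K ] χ K ≡ true}
    ... | yes (_ , χK′) = χK′
    ... | no ¬χ         = ⊥-elim (¬χ (_ , χK))

    -- A choice made from the characteristic function depends only on the class of G.
    rep : 𝒫f X → 𝒫f X
    rep G = choose (class G)

    does-true : ∀ {P : Set} (d : Dec P) → does d ≡ true → P
    does-true (yes p) _ = p

    rep-≋ : ∀ G → rep G ≋ G
    rep-≋ G = does-true em (choose-spec (class G) {G} (dec-true em ((λ x → x) , (λ x → x))))

    -- Boolean characteristic functions of equivalent sets agree pointwise, so by extensionality
    -- `choose` receives the same argument.
    rep-cong : ∀ {G K} → G ≋ K → rep G ≡ rep K
    rep-cong {G} {K} G≋K = cong choose (ext λ F → does-⇔
      (mk⇔ (λ F≋G → ≋-trans {F = F} {G} {K} F≋G G≋K)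
           (λ F≋K → ≋-trans {F = F} {K} {G} F≋K (≋-sym {G = G} {K} G≋K))) em em)

    fromList : List X → 𝒫f X
    fromList []       = default
    fromList (x ∷ xs) = fromList⁺ (x ∷ xs)

    ∈-fromList⁺ : ∀ {xs x} → x ∈ˡ xs → x ∈ᶠ fromList xs
    ∈-fromList⁺ {x ∷ xs} = ∈-fromList⁺⁺ (x ∷ xs)

    ∈-fromList⁻ : ∀ {xs x y} → y ∈ˡ xs → x ∈ᶠ fromList xs → x ∈ˡ xs
    ∈-fromList⁻ {x ∷ xs} _ = ∈-fromList⁺⁻ (x ∷ xs)

    -- The powerset also yields `G` itself and the empty list, which `fromList` sends to `default`;
    -- the filter keeps only genuine proper subsets.
    subs : 𝒫f X → List (𝒫f X)
    subs G = filter (λ K → em {P = K ⊊ G}) (map (rep ∘ fromList) (powerset (toList G)))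

    ∈subs⇒⊊ : ∀ {K G} → K ∈ˡ subs G → K ⊊ G
    ∈subs⇒⊊ {G = G} K∈ = proj₂ (∈-filter⁻ (λ K → em {P = K ⊊ G}) {xs = map (rep ∘ fromList) (powerset (toList G))} K∈)

    ⊊⇒rep∈subs : ∀ {K G} → K ⊊ G → rep K ∈ˡ subs G
    ⊊⇒rep∈subs {K} {G} K⊊G@(K⊆G , _) = ∈-filter⁺ (λ K → em {P = K ⊊ G})
      (subst (_∈ˡ map (rep ∘ fromList) (powerset (toList G))) (rep-cong {fromList ys} {K} ys≋K)
        (∈-map⁺ (rep ∘ fromList) (filter∈powerset ∈K? (toList G))))
      (⊊-resp-≋ {F = K} {G} {rep K} {G} (≋-sym {G = rep K} {K} (rep-≋ K)) ((λ x → x) , (λ x → x)) K⊊G)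
      where
      ∈K? : Decidable (_∈ᶠ K)
      ∈K? x = em
      ys : List X
      ys = filter ∈K? (toList G)
      ∈ys : ∀ {x} → x ∈ᶠ K → x ∈ˡ ys
      ∈ys x∈ = ∈-filter⁺ ∈K? (K⊆G x∈) x∈
      ys≋K : fromList ys ≋ K
      ys≋K = (λ x∈ → proj₂ (∈-filter⁻ ∈K? {xs = toList G} (∈-fromList⁻ (∈ys (here refl)) x∈))) ,
             (λ x∈ → ∈-fromList⁺ (∈ys x∈))

    ⊊⇒rep∈subs-rep : ∀ {K G} → K ⊊ G → rep K ∈ˡ subs (rep G)
    ⊊⇒rep∈subs-rep {K} {G} K⊊G = ⊊⇒rep∈subs {K} {rep G}
      (⊊-resp-≋ {F = K} {G} {K} {rep G} ((λ x → x) , (λ x → x)) (≋-sym {G = rep G} {G} (rep-≋ G)) K⊊G)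

-- One factor of the tensor product

Family : Set
Family = 𝒫f ℕ⁺^ℕ⁺

-- (z , a , s): z holds the completed coordinates, a = ∑ α (Gᵢ), and s = ∑ ∑ fᵢ t is
-- the argument of the polynomial of the current coordinate.
State : Set → Set
State Z = Z × ℕ × ℕ

-- `X G` lists the parameters with which a chain may start at `G`, and `R G` contains the states of
-- the chains that end at `G`; `start` and `cont` follow such a chain one set at a time.
record Layer (T : 𝒫f ℙ) (subs : Family → List (Family)) {Z : Set}
             (X : Family → List Z) (B : Z → Pred ℕ⁺ 0ℓ) : Set where
  field
    α     : Family → ℕ⁺
    H     : Family → 𝒫f ℕ⁺
    R     : Family → List (State Z)
    start : ∀ {G z f} → z ∈ˡ X G → f ∈ᶠ G → (z , value (α G) , ∑ (H G) (value ∘ f)) ∈ˡ R G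
    cont  : ∀ {K G z a s f} → K ∈ˡ subs G → (z , a , s) ∈ˡ R K → f ∈ᶠ G →
            (z , a + value (α G) , s + ∑ (H G) (value ∘ f)) ∈ˡ R G
    good  : ∀ {G z a s P} → (z , a , s) ∈ˡ R G → P ∈ᶠ T → (+ a +ℤ eval P (+ s)) ∈ℤ B z
    incr  : ∀ {K G} → K ∈ˡ subs G → H K ≺ H G

module Construction (em : ∀ {ℓ} → ExcludedMiddle ℓ) (ext : ∀ {a b} → Extensionality a b)
  (p : βℕ) (p∈𝒥ₚ : p ∈ 𝒥ₚ) (idem : Idempotent p) (T : 𝒫f ℙ)
  (subs : Family → List (Family))
  (subs-rank : ∀ {K G} → K ∈ˡ subs G → length (toList K) < length (toList G))
  {Z : Set} (X : Family → List Z) (B : Z → Pred ℕ⁺ 0ℓ)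
  (B∈ : ∀ {G z} → z ∈ˡ X G → B z ∈ Sets p) where

  open Classical em ext
  private module P = Ultrafilter p

  B* : Z → Pred ℕ⁺ 0ℓ
  B* z y = B z y × (λ w → B z (y +⁺ w)) ∈ Sets p

  B*∈ : ∀ {z} → B z ∈ Sets p → B* z ∈ Sets p
  B*∈ {z} b = P.inter b (proj₂ idem {B z} b)

  -- Idempotence applied to the translate of `B z` by `y`, itself a member of `p`, stars that
  -- translate; this is what lets a chain be prolonged indefinitely.
  B*-shift : ∀ {z y} → B* z y → (λ w → B* z (y +⁺ w)) ∈ Sets p
  B*-shift {z} {y} (_ , b) = P.inter b (P.upward
    (λ {u} → P.upward (λ {w} → subst (B z) (sym (+⁺-assoc y u w))))
    (proj₂ idem {λ w → B z (y +⁺ w)} b))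

  record Choice : Set where
    constructor choice
    field
      shift  : ℕ⁺
      window : 𝒫f ℕ⁺
      states : List (State Z)
  open Choice

  Spec : Family → List (State Z) → ℕ → ℕ⁺ × 𝒫f ℕ⁺ → Set
  Spec G pre N (α , H) = N < minᶠ H × (∀ {z a s} → (z , a , s) ∈ˡ pre → ∀ {f} → f ∈ᶠ G → ∀ {P} → P ∈ᶠ T →
    (+ (a + value α) +ℤ eval P (+ (s + ∑ H (value ∘ f)))) ∈ℤ B* z)

  -- The sum is formed in `ℤ` because an initial state contributes `0`, which is not in `ℕ⁺`.
  Ready : List (State Z) → Set
  Ready pre = ∀ {z a s} → (z , a , s) ∈ˡ pre → ∀ {P} → P ∈ᶠ T →
    (λ w → ((+ a +ℤ eval P (+ s)) +ℤ + value w) ∈ℤ B* z) ∈ Sets p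

  -- For each state, the `Jₚ-set` property of `C` yields a point `α + P (s + x) - P s` of `C`;
  -- adding `a + P s` cancels the last term and lands in `B* z`.
  Spec-satisfiable : ∀ G pre N → Ready pre → ∃[ αH ] Spec G pre N αH
  Spec-satisfiable G pre N ready = (α , shiftᶠ N⁺ β) , <minᶠ-shift , spec
    where
    indices : List (State Z × ℙ)
    indices = cartesianProduct pre (toList T)

    S : State Z × ℙ → Pred ℕ⁺ 0ℓ
    S ((z , a , s) , P) w = ((+ a +ℤ eval P (+ s)) +ℤ + value w) ∈ℤ B* z

    C : Pred ℕ⁺ 0ℓ
    C w = ∀ {i} → i ∈ˡ indices → S i w

    S∈ : ∀ {i} → i ∈ˡ indices → S i ∈ Sets p
    S∈ {(z , a , s) , P} i∈ with ∈-cartesianProduct⁻ pre (toList T) i∈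
    ... | st∈ , P∈ = ready st∈ P∈

    -- The successor, since `N` is `0` when there are no earlier windows.
    N⁺ : ℕ⁺
    N⁺ = pos (suc N)

    poly : State Z × ℙ → ℙ
    poly ((z , a , s) , P) = increment P (+ s)

    -- The zero polynomial in front keeps the list nonempty when `pre` is empty.
    Fs : List⁺ ℙ
    Fs = [] ∷ map poly indices

    -- Sums of delayed functions over `β` are sums of the original ones over `shiftᶠ N⁺ β`, which
    -- lies beyond `N`.
    delay : ℕ⁺^ℕ⁺ → ℕ⁺^ℕ⁺
    delay f t = f (t +⁺ N⁺)

    Hs : List⁺ ℕ⁺^ℕ⁺
    Hs = List⁺.map delay (elements G)

    jₚ : Σ[ a ∈ ℕ⁺ ] Σ[ β ∈ 𝒫f ℕ⁺ ] (∀ P f → P ∈ᶠ fromList⁺ Fs → f ∈ᶠ fromList⁺ Hs →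
           (+ value a +ℤ eval P (+ ∑ β (value ∘ f))) ∈ℤ C)
    jₚ = p∈𝒥ₚ C (⋂-∈ p indices S S∈) (fromList⁺ Fs) (fromList⁺ Hs)

    α : ℕ⁺
    α = proj₁ jₚ

    β : 𝒫f ℕ⁺
    β = proj₁ (proj₂ jₚ)

    <minᶠ-shift : N < minᶠ (shiftᶠ N⁺ β)
    <minᶠ-shift = ℕ.<-trans (ℕ.n<1+n N) (<minᶠ-shiftᶠ N⁺ β)

    lemma : ∀ a x e u → (a +ℤ e) +ℤ (x +ℤ (u - e)) ≡ (a +ℤ x) +ℤ u
    lemma = solve 4 (λ a x e u → (a :+ e) :+ (x :+ (u :- e)) := (a :+ x) :+ u) refl

    spec : ∀ {z a s} → (z , a , s) ∈ˡ pre → ∀ {f} → f ∈ᶠ G → ∀ {P} → P ∈ᶠ T →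
      (+ (a + value α) +ℤ eval P (+ (s + ∑ (shiftᶠ N⁺ β) (value ∘ f)))) ∈ℤ B* z
    spec {z} {a} {s} st∈ {f} f∈ {P} P∈ = conclude
      (proj₂ (proj₂ jₚ) (increment P (+ s)) (delay f)
        (∈-fromList⁺⁺ Fs (there (∈-map⁺ poly i∈)))
        (∈-fromList⁺⁺ Hs (∈-map⁺ delay f∈)))
      where
      open ≡-Reasoning
      i∈ : ((z , a , s) , P) ∈ˡ indices
      i∈ = ∈-cartesianProduct⁺ st∈ P∈
      Σβ : ℕ
      Σβ = ∑ β (value ∘ delay f)
      conclude : (+ value α +ℤ eval (increment P (+ s)) (+ Σβ)) ∈ℤ C →
        (+ (a + value α) +ℤ eval P (+ (s + ∑ (shiftᶠ N⁺ β) (value ∘ f)))) ∈ℤ B* z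
      conclude (n , n≡ , n∈) with n∈ i∈
      ... | y , y≡ , y∈ = y , eq , y∈
        where
        eq : + value y ≡ + (a + value α) +ℤ eval P (+ (s + ∑ (shiftᶠ N⁺ β) (value ∘ f)))
        eq = begin
          + value y
            ≡⟨ y≡ ⟩
          (+ a +ℤ eval P (+ s)) +ℤ + value n
            ≡⟨ cong ((+ a +ℤ eval P (+ s)) +ℤ_) n≡ ⟩
          (+ a +ℤ eval P (+ s)) +ℤ (+ value α +ℤ eval (increment P (+ s)) (+ Σβ))
            ≡⟨ cong (λ e → (+ a +ℤ eval P (+ s)) +ℤ (+ value α +ℤ e)) (eval-increment P (+ s) (+ Σβ)) ⟩
          (+ a +ℤ eval P (+ s)) +ℤ (+ value α +ℤ (eval P (+ (s + Σβ)) - eval P (+ s)))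
            ≡⟨ lemma (+ a) (+ value α) (eval P (+ s)) (eval P (+ (s + Σβ))) ⟩
          + (a + value α) +ℤ eval P (+ (s + Σβ))
            ≡⟨ cong (λ σ → + (a + value α) +ℤ eval P (+ (s + σ))) (∑-shiftᶠ N⁺ β (value ∘ f)) ⟩
          + (a + value α) +ℤ eval P (+ (s + ∑ (shiftᶠ N⁺ β) (value ∘ f))) ∎

  singleton : 𝒫f ℕ⁺
  singleton = record { elements = 1⁺ ∷ [] ; unique = [] ∷ [] }

  abstract
    -- The fallback makes `pick` total, so the recursion can be defined first and readiness proved
    -- afterwards.
    pick : Family → List (State Z) → ℕ → ℕ⁺ × 𝒫f ℕ⁺
    pick G pre N with em {P = ∃[ αH ] Spec G pre N αH}
    ... | yes (αH , _) = αH
    ... | no _         = 1⁺ , singleton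

    pick-Spec : ∀ G pre N → Ready pre → Spec G pre N (pick G pre N)
    pick-Spec G pre N ready with em {P = ∃[ αH ] Spec G pre N αH}
    ... | yes (_ , spec) = spec
    ... | no ¬spec       = ⊥-elim (¬spec (Spec-satisfiable G pre N ready))

  before : Family → List Choice → List (State Z)
  before G cs = map (λ z → z , 0 , 0) (X G) ++ concatMap states cs

  -- A sum of maxima dominates each of them, so one bound places the new window past all earlier
  -- ones.
  bound : List Choice → ℕ
  bound cs = sum (map (maxᶠ ∘ window) cs)

  build : Family → List Choice → Choice
  build G cs = let αH = pick G (before G cs) (bound cs) in
    choice (proj₁ αH) (proj₂ αH)
      (cartesianProductWith
        (λ (z , a , s) f → z , a + value (proj₁ αH) , s + ∑ (proj₂ αH) (value ∘ f))
        (before G cs) (toList G))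

  -- stage n is the intended choice only on the sets of rank at most n.
  stage : ℕ → Family → Choice
  stage zero    G = build G []
  stage (suc n) G = build G (map (stage n) (subs G))

  stage-stable : ∀ m n G → rank G ≤ m → rank G ≤ n → stage m G ≡ stage n G
  -- Finite sets here are nonempty, so their rank is positive and zero bounds cannot occur.
  stage-stable (suc m) (suc n) G r≤m r≤n = cong (build G) (map-cong-local (All.tabulate λ {K} K∈ →
    stage-stable m n K (ℕ.≤-pred (ℕ.≤-trans (subs-rank K∈) r≤m)) (ℕ.≤-pred (ℕ.≤-trans (subs-rank K∈) r≤n))))

  final : Family → Choice
  final G = stage (rank G) G

  final-build : ∀ G → final G ≡ build G (map final (subs G))
  final-build G = cong (build G) (map-cong-local (All.tabulate λ {K} K∈ →
    stage-stable _ (rank K) K (ℕ.≤-pred (subs-rank K∈)) ℕ.≤-refl))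

  previous : Family → List Choice
  previous G = map final (subs G)

  Good : Family → Set
  Good G = ∀ {z a s} → (z , a , s) ∈ˡ states (final G) → ∀ {P} → P ∈ᶠ T → (+ a +ℤ eval P (+ s)) ∈ℤ B* z

  ready : ∀ G → (∀ {K} → K ∈ˡ subs G → Good K) → Ready (before G (previous G))
  ready G good st∈ {P} P∈ with ∈-++⁻ (map (λ z → z , 0 , 0) (X G)) st∈
  ... | inj₁ st∈₁ with z , z∈ , refl ← ∈-map⁻ _ st∈₁ =
    P.upward (λ {w} b → w , sym (trans (cong (λ e → 0ℤ +ℤ e +ℤ + value w) (eval-0 P)) (ℤ.+-identityˡ _)) , b)
      (B*∈ (B∈ z∈))
  ... | inj₂ st∈₂ with cs , st∈cs , cs∈ ← ∈-concat⁻′ (map states (previous G)) st∈₂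
                  with c , c∈ , refl ← ∈-map⁻ states cs∈
                  with K , K∈ , refl ← ∈-map⁻ final c∈
                  with y , y≡ , b ← good K∈ st∈cs P∈ =
    P.upward (λ {w} b → y +⁺ w , cong (_+ℤ + value w) y≡ , b) (B*-shift b)

  -- Good states below `G` make the list `before` ready, readiness makes `pick` meet its `Spec`, and
  -- that makes the states at `G` good.
  good-all : ∀ n G → rank G ≤ n → Good G
  good-all (suc n) G r≤n {z} {a} {s} st∈ {P} P∈
    with ∈-cartesianProductWith⁻ _ (before G (previous G)) (toList G)
           (subst (λ c → (z , a , s) ∈ˡ states c) (final-build G) st∈)
  ... | _ , f , pre∈ , f∈ , refl = proj₂ (pick-Spec G _ (bound (previous G)) (ready G below)) pre∈ f∈ P∈
    where
    below : ∀ {K} → K ∈ˡ subs G → Good K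
    below {K} K∈ = good-all n K (ℕ.≤-pred (ℕ.≤-trans (subs-rank K∈) r≤n))

  good : ∀ G → Good G
  good G = good-all (rank G) G ℕ.≤-refl

  step : ∀ {G z a s f} → (z , a , s) ∈ˡ before G (previous G) → f ∈ᶠ G →
         (z , a + value (shift (final G)) , s + ∑ (window (final G)) (value ∘ f)) ∈ˡ states (final G)
  step {G} {z} {a} {s} {f} st∈ f∈ = subst
    (λ c → (z , a + value (shift c) , s + ∑ (window c) (value ∘ f)) ∈ˡ states c)
    (sym (final-build G)) (∈-cartesianProductWith⁺ _ st∈ f∈)

  final-incr : ∀ {K G} → K ∈ˡ subs G → window (final K) ≺ window (final G)
  final-incr {K} {G} K∈ = ℕ.≤-<-trans
    (∈⇒≤sum (∈-map⁺ (maxᶠ ∘ window) (∈-map⁺ final K∈)))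
    (subst (λ c → bound (previous G) < minᶠ (window c)) (sym (final-build G))
      (proj₁ (pick-Spec G _ (bound (previous G)) (ready G λ {K} _ → good K))))

  layer : Layer T subs X B
  layer = record
    { α     = shift ∘ final
    ; H     = window ∘ final
    ; R     = states ∘ final
    ; start = λ z∈ f∈ → step (∈-++⁺ˡ (∈-map⁺ (λ z → z , 0 , 0) z∈)) f∈
    ; cont  = λ {K} {G} K∈ st∈ f∈ → step (∈-++⁺ʳ (map (λ z → z , 0 , 0) (X G))
        (∈-concat⁺′ st∈ (∈-map⁺ states (∈-map⁺ final K∈)))) f∈
    ; good  = λ {G} st∈ P∈ → let y , y≡ , b , _ = good G st∈ P∈ in y , y≡ , b
    ; incr  = final-incr
    }

-- Iteration over the factors

open Sort (On.decTotalOrder ℕ.≤-decTotalOrder value) using (sort; sort-↭; sort-↗)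

last⁺ : ℕ⁺ → List ℕ⁺ → ℕ⁺
last⁺ i []      = i
last⁺ i (j ∷ l) = last⁺ j l

last⁺-∈ : ∀ i l → last⁺ i l ∈ˡ i ∷ l
last⁺-∈ i []      = here refl
last⁺-∈ i (j ∷ l) = there (last⁺-∈ j l)

-- The enumeration inside `𝒫f` has arbitrary order, whereas a chain of sets is followed upwards.
record Ascending (β : 𝒫f ℕ⁺) : Set where
  field
    first      : ℕ⁺
    rest       : List ℕ⁺
    increasing : AllPairs _<⁺_ (first ∷ rest)
    permutes   : first ∷ rest ↭ toList β

  last : ℕ⁺
  last = last⁺ first rest

  ∈β : ∀ {i} → i ∈ˡ first ∷ rest → i ∈ᶠ β
  ∈β = ∈-resp-↭ permutes

  ∑-sorted : ∀ g → sum (map g (first ∷ rest)) ≡ ∑ β g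
  ∑-sorted g = sum-↭ (↭-map⁺ g permutes)

ascending : ∀ β → Ascending β
ascending β = go (sort (toList β)) (sort-↭ (toList β)) strict
  where
  strict : AllPairs _<⁺_ (sort (toList β))
  strict = AllPairs.zipWith (λ { (i≤j , i≢j) → ℕ.≤∧≢⇒< i≤j (i≢j ∘ value-injective) })
    (Linked⇒AllPairs ℕ.≤-trans (sort-↗ (toList β)) ,
     ↭ₛ.Unique-resp-↭ (setoid ℕ⁺) (↭⇒↭ₛ (↭-sym (sort-↭ (toList β)))) (𝒫f.unique β))
  go : ∀ l → l ↭ toList β → AllPairs _<⁺_ l → Ascending β
  go []      perm inc with () ← ∈-resp-↭ (↭-sym perm) (here refl)
  go (i ∷ l) perm inc = record { first = i ; rest = l ; increasing = inc ; permutes = perm }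

_▷_ : ∀ {k} {A : Set} → (Fin k → A) → A → Fin (suc k) → A
_▷_ {zero}  a x _       = x
_▷_ {suc k} a x zero    = a zero
_▷_ {suc k} a x (suc j) = ((a ∘ suc) ▷ x) j

▷-inject₁ : ∀ {k} {A : Set} (a : Fin k → A) x j → (a ▷ x) (inject₁ j) ≡ a j
▷-inject₁ a x zero    = refl
▷-inject₁ a x (suc j) = ▷-inject₁ (a ∘ suc) x j

▷-fromℕ : ∀ {k} {A : Set} (a : Fin k → A) x → (a ▷ x) (fromℕ k) ≡ x
▷-fromℕ {zero}  a x = refl
▷-fromℕ {suc k} a x = ▷-fromℕ (a ∘ suc) x

snoc-elim : ∀ {k} (Q : Fin (suc k) → Set) → (∀ j → Q (inject₁ j)) → Q (fromℕ k) → ∀ j → Q j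
snoc-elim Q q x j with view j
... | ‵fromℕ = x
... | ‵inj₁ {i = i} _ = q i

lookup-∷ʳ-inject₁ : ∀ {A : Set} {k} (v : Vec A k) x j → lookup (v ∷ʳ x) (inject₁ j) ≡ lookup v j
lookup-∷ʳ-inject₁ (y ∷ v) x zero    = refl
lookup-∷ʳ-inject₁ (y ∷ v) x (suc j) = lookup-∷ʳ-inject₁ v x j

lookup-∷ʳ-fromℕ : ∀ {A : Set} {k} (v : Vec A k) x → lookup (v ∷ʳ x) (fromℕ k) ≡ x
lookup-∷ʳ-fromℕ []      x = refl
lookup-∷ʳ-fromℕ (y ∷ v) x = lookup-∷ʳ-fromℕ v x

-- One coordinate of the point in `CentralSetsConclusion`.
entry : (α : Family → ℕ⁺) (H : Family → 𝒫f ℕ⁺) (G : ℕ⁺ → Family) (f : ℕ⁺ → ℕ⁺^ℕ⁺) → 𝒫f ℕ⁺ → ℙ → ℤ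
entry α H G f β P = + ∑ β (λ i → value (α (G i))) +ℤ eval P (+ ∑ β (λ i → ∑ (H (G i)) (λ t → value (f i t))))

module Systems (T : 𝒫f ℙ) (subs : Family → List Family) where

  -- `nested` covers all pairs and not just neighbours, because the elements of a `β` may skip
  -- indices.
  record Tower (n : ℕ) (G : ℕ⁺ → Family) (f : ℕ⁺ → ℕ⁺^ℕ⁺) : Set where
    field
      nested : ∀ {i j} → i <⁺ j → value j ≤ n → G i ∈ˡ subs (G j)
      member : ∀ {i} → value i ≤ n → f i ∈ᶠ G i

  -- `Y G` holds the tuples whose last chain ends at `G`. They are finitely many points of `A`, fit
  -- to be parameters for the next factor.
  record System {k} (A : Pred (Vec ℕ⁺ (suc k)) 0ℓ) : Set where
    field
      α     : Fin (suc k) → Family → ℕ⁺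
      H     : Fin (suc k) → Family → 𝒫f ℕ⁺
      Y     : Family → List (Vec ℕ⁺ (suc k))
      Y⊆A   : ∀ {G v} → v ∈ˡ Y G → v ∈ A
      incr  : ∀ j {K G} → K ∈ˡ subs G → H j K ≺ H j G
      chain : ∀ {n G f} → Tower n G f → (β : Fin (suc k) → 𝒫f ℕ⁺) →
              (∀ (j : Fin k) → β (inject₁ j) ≺ β (suc j)) → maxᶠ (β (fromℕ k)) ≤ n →
              (P : Fin (suc k) → ℙ) → (∀ j → P j ∈ᶠ T) →
              ∃[ v ] v ∈ˡ Y (G (Ascending.last (ascending (β (fromℕ k))))) ×
                (∀ j → + value (lookup v j) ≡ entry (α j) (H j) G f (β j) (P j))

  module _ {Z : Set} {X : Family → List Z} {B : Z → Pred ℕ⁺ 0ℓ} (L : Layer T subs X B) where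
    open Layer L

    -- The smallest index of `β` opens a chain by `start`, and each later one prolongs it by `cont`.
    Layer-chain : ∀ {n G f} → Tower n G f → ∀ β → maxᶠ β ≤ n →
      ∀ {z} → z ∈ˡ X (G (Ascending.first (ascending β))) →
      (z , ∑ β (λ i → value (α (G i))) , ∑ β (λ i → ∑ (H (G i)) (λ t → value (f i t))))
        ∈ˡ R (G (Ascending.last (ascending β)))
    Layer-chain {n} {G} {f} tower β max≤n {z} z∈ = subst₂
      (λ a s → (z , a , s) ∈ˡ R (G last)) (∑-sorted a) (∑-sorted s)
      (go first rest increasing bounded (start z∈ (member (bounded (here refl)))))
      where
      open Ascending (ascending β)
      open Tower tower
      a s : ℕ⁺ → ℕ
      a i = value (α (G i))
      s i = ∑ (H (G i)) (λ t → value (f i t))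
      bounded : ∀ {i} → i ∈ˡ first ∷ rest → value i ≤ n
      bounded i∈ = ℕ.≤-trans (∈⇒≤maxᶠ β (∈β i∈)) max≤n
      go : ∀ i l {u w} → AllPairs _<⁺_ (i ∷ l) → (∀ {j} → j ∈ˡ i ∷ l → value j ≤ n) →
           (z , u , w) ∈ˡ R (G i) →
           (z , u + sum (map a l) , w + sum (map s l)) ∈ˡ R (G (last⁺ i l))
      go i [] {u} {w} _ _ st∈ = subst₂ (λ u w → (z , u , w) ∈ˡ R (G i))
        (sym (ℕ.+-identityʳ u)) (sym (ℕ.+-identityʳ w)) st∈
      go i (j ∷ l) {u} {w} ((i<j ∷ _) ∷ inc) ≤n st∈ = subst₂ (λ u w → (z , u , w) ∈ˡ R (G (last⁺ j l)))
        (ℕ.+-assoc u (a j) _) (ℕ.+-assoc w (s j) _)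
        (go j l inc (≤n ∘ there)
          (cont (nested i<j (≤n (there (here refl)))) st∈ (member (≤n (there (here refl))))))

  module Extend {k} (A : Pred (Vec ℕ⁺ (suc k)) 0ℓ) {X : Family → List (Vec ℕ⁺ k)}
                (L : Layer T subs X (λ z y → A (z ∷ʳ y))) where
    open Layer L

    extend : State (Vec ℕ⁺ k) → ℙ → Vec ℕ⁺ (suc k)
    -- On the states of `R G` and the polynomials of `T` the value is positive by `good`, so the
    -- junk value of `toℕ⁺` does not enter.
    extend (z , a , s) P = z ∷ʳ toℕ⁺ (+ a +ℤ eval P (+ s))

    Y : Family → List (Vec ℕ⁺ (suc k))
    Y G = cartesianProductWith extend (R G) (toList T)

    Y⊆A : ∀ {G v} → v ∈ˡ Y G → v ∈ A
    Y⊆A {G} v∈ with ∈-cartesianProductWith⁻ extend (R G) (toList T) v∈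
    ... | (z , a , s) , P , st∈ , P∈ , refl with good st∈ P∈
    ... | y , y≡ , y∈ = subst (λ y → A (z ∷ʳ y)) (sym (value-toℕ⁺ (sym y≡))) y∈

    extend-chain : ∀ {n G f} → Tower n G f → ∀ β → maxᶠ β ≤ n → ∀ {P} → P ∈ᶠ T →
      ∀ {z} → z ∈ˡ X (G (Ascending.first (ascending β))) →
      ∃[ y ] (z ∷ʳ y) ∈ˡ Y (G (Ascending.last (ascending β))) × + value y ≡ entry α H G f β P
    extend-chain tower β max≤n P∈ z∈ with Layer-chain L tower β max≤n z∈
    ... | st∈ = _ , ∈-cartesianProductWith⁺ extend st∈ P∈ ,
      let y , y≡ , _ = good st∈ P∈ in trans (cong (λ y → + value y) (value-toℕ⁺ {n = y} (sym y≡))) y≡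

  base : (A : Pred (Vec ℕ⁺ 1) 0ℓ) → Layer T subs (λ _ → [] ∷ []) (λ z y → A (z ∷ʳ y)) → System A
  base A L = record
    { α     = λ _ → α
    ; H     = λ _ → H
    ; Y     = Y
    ; Y⊆A   = λ {G} → Y⊆A {G}
    ; incr  = λ _ → incr
    ; chain = λ tower β β≺ max≤n P P∈ →
        let y , v∈ , y≡ = extend-chain tower (β zero) max≤n (P∈ zero) (here refl)
        in [] ∷ʳ y , v∈ , λ { zero → y≡ }
    }
    where
    open Layer L
    open Extend A L

  -- The old tuples end at the largest index of the penultimate `β`, which precedes the first index
  -- of the last `β`. Thus they were completed strictly below the set where the new chain starts,
  -- and are parameters there.
  snoc : ∀ {k} {A′ : Pred (Vec ℕ⁺ (suc k)) 0ℓ} (A : Pred (Vec ℕ⁺ (suc (suc k))) 0ℓ) (S : System A′) →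
         Layer T subs (concatMap (System.Y S) ∘ subs) (λ z y → A (z ∷ʳ y)) → System A
  snoc {k} A S L = record
    { α     = S.α ▷ α
    ; H     = S.H ▷ H
    ; Y     = Y
    ; Y⊆A   = λ {G} → Y⊆A {G}
    ; incr  = λ j {K} {G} K∈ → snoc-elim (λ j → (S.H ▷ H) j K ≺ (S.H ▷ H) j G)
        (λ j → subst (λ h → h K ≺ h G) (sym (▷-inject₁ S.H H j)) (S.incr j K∈))
        (subst (λ h → h K ≺ h G) (sym (▷-fromℕ S.H H)) (incr K∈)) j
    ; chain = chain
    }
    where
    module S = System S
    open Layer L
    open Extend A L

    chain : ∀ {n G f} → Tower n G f → (β : Fin (suc (suc k)) → 𝒫f ℕ⁺) →
            (∀ (j : Fin (suc k)) → β (inject₁ j) ≺ β (suc j)) → maxᶠ (β (fromℕ (suc k))) ≤ n →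
            (P : Fin (suc (suc k)) → ℙ) → (∀ j → P j ∈ᶠ T) →
            ∃[ v ] v ∈ˡ Y (G (Ascending.last (ascending (β (fromℕ (suc k)))))) ×
              (∀ j → + value (lookup v j) ≡ entry ((S.α ▷ α) j) ((S.H ▷ H) j) G f (β j) (P j))
    chain {n} {G} {f} tower β β≺ max≤n P P∈ = result
      where
      β′ βₗ : 𝒫f ℕ⁺
      β′ = β (inject₁ (fromℕ k))
      βₗ = β (fromℕ (suc k))
      module β′ = Ascending (ascending β′)
      module βₗ = Ascending (ascending βₗ)

      first∈ : βₗ.first ∈ᶠ βₗ
      first∈ = βₗ.∈β (here refl)

      first≤n : value βₗ.first ≤ n
      first≤n = ℕ.≤-trans (∈⇒≤maxᶠ βₗ first∈) max≤n

      max′<first : maxᶠ β′ < value βₗ.first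
      max′<first = ℕ.<-≤-trans (β≺ (fromℕ k)) (minᶠ≤∈ βₗ first∈)

      last<first : β′.last <⁺ βₗ.first
      last<first = ℕ.≤-<-trans (∈⇒≤maxᶠ β′ (β′.∈β (last⁺-∈ β′.first β′.rest))) max′<first

      result : _
      result with S.chain tower (β ∘ inject₁) (β≺ ∘ inject₁)
                    (ℕ.≤-trans (ℕ.<⇒≤ max′<first) first≤n) (P ∘ inject₁) (P∈ ∘ inject₁)
      ... | v , v∈ , v≡ with extend-chain tower βₗ max≤n (P∈ (fromℕ (suc k)))
                               (∈-concat⁺′ v∈ (∈-map⁺ S.Y (Tower.nested tower last<first first≤n)))
      ... | y , vy∈ , y≡ = v ∷ʳ y , vy∈ , snoc-elim _
        (λ j → trans (cong (λ w → + value w) (lookup-∷ʳ-inject₁ v y j)) (trans (v≡ j)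
          (sym (cong₂ (λ α H → entry α H G f (β (inject₁ j)) (P (inject₁ j))) (▷-inject₁ S.α α j) (▷-inject₁ S.H H j)))))
        (trans (cong (λ w → + value w) (lookup-∷ʳ-fromℕ v y)) (trans y≡
          (sym (cong₂ (λ α H → entry α H G f βₗ (P (fromℕ (suc k)))) (▷-fromℕ S.α α) (▷-fromℕ S.H H)))))

-- Assembly of the theorem

module Main (em : ∀ {ℓ} → ExcludedMiddle ℓ) (ext : ∀ {a b} → Extensionality a b) where
  open Classical em ext
  open Canonical {ℕ⁺^ℕ⁺} (fromList⁺ ((λ _ → 1⁺) ∷ []))

  module _ (T : 𝒫f ℙ) where
    open Systems T subs

    subs-rank : ∀ {K G} → K ∈ˡ subs G → rank K < rank G
    subs-rank {K} {G} K∈ = ⊊⇒rank< {K = K} {G} (∈subs⇒⊊ {K} {G} K∈)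

    -- By definition of `⨂`, the tuples whose fibre in `A` belongs to the last ultrafilter form a
    -- member of the shorter product. A system for that set has only such tuples in `Y`, as the
    -- layer for the last factor demands.
    system : ∀ {k} (p : Fin (suc k) → βℕ) → (∀ i → p i ∈ 𝒥ₚ × Idempotent (p i)) →
             (A : Pred (Vec ℕ⁺ (suc k)) 0ℓ) → A ∈ Sets (⨂ p) → System A
    system {zero} p hyp A A∈ = base A
      (Construction.layer em ext (p zero) (proj₁ (hyp zero)) (proj₂ (hyp zero)) T subs
        (λ {K} {G} → subs-rank {K} {G}) (λ _ → [] ∷ []) (λ z y → A (z ∷ʳ y)) λ { {G} (here refl) → A∈ })
    system {suc k} p hyp A A∈ = snoc A S
      (Construction.layer em ext (p last) (proj₁ (hyp last)) (proj₂ (hyp last)) T subs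
        (λ {K} {G} → subs-rank {K} {G}) (concatMap S.Y ∘ subs) (λ z y → A (z ∷ʳ y))
        λ {G} z∈ → let ys , z∈ys , ys∈ = ∈-concat⁻′ (map S.Y (subs G)) z∈
                       K , K∈ , ys≡ = ∈-map⁻ S.Y ys∈
                   in S.Y⊆A (subst (_ ∈ˡ_) ys≡ z∈ys))
      where
      last : Fin (suc (suc k))
      last = fromℕ (suc k)
      S : System (λ z → (λ y → A (z ∷ʳ y)) ∈ Sets (p last))
      S = system (p ∘ inject₁) (hyp ∘ inject₁) _ A∈
      module S = System S

  conclusion : ∀ {k} (p : Fin (suc k) → βℕ) → (∀ i → p i ∈ 𝒥ₚ × Idempotent (p i)) → CentralSetsConclusion p
  conclusion {k} p hyp A A∈ T =
    -- Composition with `rep` makes the functions independent of the enumeration of their argument.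
    (λ j → S.α j ∘ rep) , (λ j → S.H j ∘ rep) ,
    (λ j {G} {K} G≋K → cong (S.α j) (rep-cong {G} {K} G≋K)) ,
    (λ j {G} {K} G≋K → subst (λ E → S.H j (rep G) ≋ S.H j E) (rep-cong {G} {K} G≋K) ((λ x → x) , (λ x → x))) ,
    (λ G K G⊊K j → S.incr j (⊊⇒rep∈subs-rep {G} {K} G⊊K)) ,
    λ n _ G ⊊G β β≺ max≤n f f∈ P P∈ →
      let v , v∈ , v≡ = S.chain (tower n G ⊊G f f∈) β β≺ max≤n P P∈ in v , v≡ , S.Y⊆A v∈
    where
    open Systems T subs
    S : System A
    S = system T p hyp A A∈
    module S = System S

    increasing : ∀ n (G : ℕ⁺ → Family) → (∀ i → value i < n → G i ⊊ G (i +⁺ 1⁺)) →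
                 ∀ d i j → value j ≡ value i + suc d → value j ≤ n → G i ⊊ G j
    increasing n G ⊊G zero i j j≡ j≤n =
      subst (λ j → G i ⊊ G j) (sym (value-injective {j} {i +⁺ 1⁺} j≡))
        (⊊G i (subst (_≤ n) (trans j≡ (ℕ.+-comm (value i) 1)) j≤n))
    increasing n G ⊊G (suc d) i j j≡ j≤n = ⊊-trans {F = G i} {G (i +⁺ 1⁺)} {G j}
      (⊊G i (ℕ.<-≤-trans (subst (value i <_) (sym j≡) (ℕ.m<m+n (value i) (s≤s z≤n))) j≤n))
      (increasing n G ⊊G d (i +⁺ 1⁺) j (trans j≡ (sym (ℕ.+-assoc (value i) 1 (suc d)))) j≤n)

    tower : ∀ n (G : ℕ⁺ → Family) → (∀ i → value i < n → G i ⊊ G (i +⁺ 1⁺)) →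
            ∀ f → (∀ i → value i ≤ n → f i ∈ᶠ G i) → Tower n (rep ∘ G) f
    tower n G ⊊G f f∈ = record
      { nested = λ {i} {j} i<j j≤n → ⊊⇒rep∈subs-rep {G i} {G j}
          (let d , ≡j = ℕ.m≤n⇒∃[o]m+o≡n i<j
           in increasing n G ⊊G d i j (trans (sym ≡j) (sym (ℕ.+-suc (value i) d))) j≤n)
      ; member = λ {i} i≤n → proj₂ (rep-≋ (G i)) (f∈ i i≤n)
      }

theorem1p29 : (∀ {ℓ} → ExcludedMiddle ℓ) →
    (∀ {a b} → Extensionality a b) →
    (k : ℕ) (p : Fin (suc k) → βℕ) →
    ((∀ i → MinimalIdempotent (p i)) → CentralSetsConclusion p)
    ×
    ((∀ i → p i ∈ 𝒥ₚ × Idempotent (p i)) → CentralSetsConclusion p)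
theorem1p29 em ext k p =
  (λ minimal → conclusion p λ i → minimal⇒𝒥ₚ (minimal i) , proj₁ (minimal i)) , conclusion p
  where
  open Main em ext using (conclusion)
  open Minimal em using (minimal⇒𝒥ₚ)
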